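{- For $m,d\ge 0$ let $H_d(m)$ be the number of partitions of $2m$ of Durfee size $d$ for which the hook length of every cell on the main diagonal is even. For $d\geq 1$, $$\sum_{m\geq0}H_d(m)q^m=\frac{2q^{\binom{d+1}{2}}(-q;q)_{d-1}}{(q;q)_d^2},$$ and for $d=0$ the generating function $\sum_{m\ge0}H_0(m)q^m$ is $1$. Moreover, the right-hand side of the displayed formula is the generating function for overpartitions (by size) whose Frobenius representation has $d$ columns. Thus the equinumerosity between partitions of $2m$ all of whose principal hooks are even and overpartitions of $m$ is refined by the Durfee-size/Frobenius-column statistic: for all $m,d\ge 0$, $H_d(m)$ equals the number of overpartitions of $m$ whose Frobenius representation has $d$ columns.
   Context: Notation: $(a;q)_N=\prod_{j=0}^{N-1}(1-aq^j)$. The Durfee size of a partition is the side of the largest square contained in its Young diagram; the principal hooks are the hooks of the cells on the main diagonal. An overpartition is a partition in which the first occurrence of each distinct part may be overlined. The Frobenius representation of an overpartition with $d$ columns is a two-row array whose top row consists of $d$ distinct nonnegative integers (in decreasing order) and whose bottom row is an overpartition into $d$ nonnegative parts (parts equal to $0$ allowed, the first occurrence of each distinct value, including $0$, may be overlined); its weight is $d$ plus the sum of all entries. It is a standard fact (Corteel–Lovejoy, Lovejoy) that overpartitions of $m$ are in bijection with such arrays of weight $m$ (over all $d\ge0$); the number of overpartitions of $m$ whose Frobenius representation has $d$ columns is the number of such arrays with $d$ columns and weight $m$. -}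

module Defs where

open import Data.Bool.Base using (Bool; true; false)
import Data.Bool.Properties as Bool
open import Data.Fin.Base using (Fin; toℕ)
import Data.Fin.Permutation as Permutation
open import Data.Integer.Base as ℤ using (ℤ; +_; 0ℤ; 1ℤ)
import Data.Integer.Properties as ℤ
open import Data.Irrelevant using ([_])
open import Data.List.Base as List using (List; []; _∷_; length; lookup)
open import Data.List.Membership.Propositional using (_∈_)
open import Data.List.Membership.Propositional.Properties
  using (∈-lookup; ∈-filter⁺; ∈-filter⁻; ∈-deduplicate⁺; ∈-deduplicate⁻;
         ∈-upTo⁺; ∈-cartesianProductWith⁺; ∈-cartesianProduct⁺)
open import Data.List.Relation.Unary.All as All using (All; []; _∷_)
open import Data.List.Relation.Unary.Any as Any using (here; there)
open import Data.List.Relation.Unary.Any.Properties using (lookup-index)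
open import Data.List.Relation.Unary.Linked as Linked using (Linked)
open import Data.List.Relation.Unary.Unique.Propositional using (Unique)
open import Data.List.Relation.Unary.Unique.DecPropositional.Properties
  using (deduplicate-!)
open import Data.List.Relation.Unary.AllPairs using (_∷_)
open import Data.Nat.Base as ℕ using (ℕ; zero; suc; _≤_; _<_; _>_; _≥_; z≤n; s≤s)
open import Data.Nat.Divisibility using (_∣_; _∣?_)
open import Data.Nat.ListAction using (sum)
import Data.Nat.Properties as ℕ
open import Data.Product.Base using (_×_; _,_; proj₁; proj₂)
import Data.Product.Properties as Product
open import Data.Refinement.Base using (Refinement-syntax; value; _,_)
open import Data.Vec.Base as Vec using (Vec; []; _∷_)
import Data.Vec.Properties as Vec
import Data.Vec.Relation.Unary.All as VecAll
import Data.Vec.Relation.Unary.AllPairs as VecPairs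
import Data.Vec.Relation.Unary.Linked as VecLinked
open import Function.Base using (_∘_)
open import Function.Bundles using (_↔_; mk↔ₛ′)
open import Function.Properties.Inverse using (↔-sym; ↔-trans)
open import Relation.Binary.Definitions using (DecidableEquality)
open import Relation.Binary.PropositionalEquality
  using (_≡_; _≢_; _≗_; refl; sym; trans; cong; cong₂; module ≡-Reasoning)
open import Relation.Nullary using (yes; no; contradiction)
open import Relation.Nullary.Decidable
  using (map′; _×-dec_; _→-dec_; ¬?; recompute)
open import Relation.Unary using (Decidable)

import Algebra.Properties.Monoid.Sum ℤ.+-0-monoid as ∑
open ∑ using (sum-syntax)

record Finite (A : Set) : Set where
  field
    size        : ℕ
    enumeration : Fin size ↔ A

open Finite public

size-unique : ∀ {A : Set} {n} (fin : Finite A) → Fin n ↔ A → size fin ≡ n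
size-unique fin e = Permutation.↔⇒≡ (↔-trans (enumeration fin) (↔-sym e))

module _ {A : Set} (_≟_ : DecidableEquality A) {P : A → Set} (P? : Decidable P)
         (candidates : List A) (complete : ∀ {x} → P x → x ∈ candidates)
         where

  private
    elems : List A
    elems = List.deduplicate _≟_ (List.filter P? candidates)

    ∈-elems : ∀ {x} → P x → x ∈ elems
    ∈-elems p = ∈-deduplicate⁺ _≟_ (∈-filter⁺ P? (complete p) p)

    elems-P : ∀ {x} → x ∈ elems → P x
    elems-P = proj₂ ∘ ∈-filter⁻ P? {xs = candidates} ∘ ∈-deduplicate⁻ _≟_ _

    index-lookup : ∀ {xs : List A} → Unique xs → ∀ i {x} (x∈ : x ∈ xs) →
                   x ≡ lookup xs i → Any.index x∈ ≡ i
    index-lookup (_ ∷ _)  Fin.zero    (here _)   _  = refl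
    index-lookup (q ∷ _)  Fin.zero    (there x∈) eq =
      contradiction (sym eq) (All.lookup q x∈)
    index-lookup (q ∷ _)  (Fin.suc i) (here x≡)  eq =
      contradiction (trans (sym x≡) eq) (All.lookup q (∈-lookup i))
    index-lookup (_ ∷ us) (Fin.suc i) (there x∈) eq =
      cong Fin.suc (index-lookup us i x∈ eq)

    value-injective : ∀ {u v : [ x ∈ A ∣ P x ]} → value u ≡ value v → u ≡ v
    value-injective refl = refl

    to : Fin (length elems) → [ x ∈ A ∣ P x ]
    to i = lookup elems i , [ elems-P (∈-lookup i) ]

    member : (u : [ x ∈ A ∣ P x ]) → value u ∈ elems
    member (x , [ p ]) = ∈-elems (recompute (P? x) p)

  refinement-finite : Finite [ x ∈ A ∣ P x ]
  refinement-finite = record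
    { size        = length elems
    ; enumeration = mk↔ₛ′ to (Any.index ∘ member)
        (λ u → value-injective (sym (lookup-index (member u))))
        (λ i → index-lookup (deduplicate-! _≟_ _) i (member (to i)) refl)
    }

-- Formal power series in q over ℤ, as coefficient sequences; equality is _≗_.
PowerSeries : Set
PowerSeries = ℕ → ℤ

infixl 6 _⊖_
infixl 7 _·_ _÷_[_]
infix  8 ⊝_

q^_ : ℕ → PowerSeries
(q^ k) n with k ℕ.≟ n
... | yes _ = 1ℤ
... | no  _ = 0ℤ

const : ℤ → PowerSeries
const c zero    = c
const c (suc n) = 0ℤ

𝟙 : PowerSeries
𝟙 = const 1ℤ

⊝_ : PowerSeries → PowerSeries
(⊝ f) n = ℤ.- f n

_⊖_ : PowerSeries → PowerSeries → PowerSeries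
(f ⊖ g) n = f n ℤ.- g n

_·_ : PowerSeries → PowerSeries → PowerSeries
(f · g) n = ∑[ i < suc n ] (f (toℕ i) ℤ.* g (n ℕ.∸ toℕ i))

-- Long division.  With g 0 ≡ 1 the leading coefficient of the quotient is f 0,
-- and the remaining ones are those of ((f - f 0 · g) / q) / g.
_÷_[_] : (f g : PowerSeries) → .(g 0 ≡ 1ℤ) → PowerSeries
(f ÷ g [ u ]) zero    = f 0
(f ÷ g [ u ]) (suc n) = ((λ k → f (suc k) ℤ.- f 0 ℤ.* g (suc k)) ÷ g [ u ]) n

÷-· : ∀ f g (u : g 0 ≡ 1ℤ) → f ÷ g [ u ] · g ≗ f
÷-· f g u zero = begin
  f 0 ℤ.* g 0 ℤ.+ 0ℤ ≡⟨ ℤ.+-identityʳ _ ⟩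
  f 0 ℤ.* g 0        ≡⟨ cong (f 0 ℤ.*_) u ⟩
  f 0 ℤ.* 1ℤ         ≡⟨ ℤ.*-identityʳ _ ⟩
  f 0                ∎
  where open ≡-Reasoning
÷-· f g u (suc n) = begin
  f 0 ℤ.* g (suc n) ℤ.+ (f′ ÷ g [ u ] · g) n
    ≡⟨ cong (ℤ._+_ (f 0 ℤ.* g (suc n))) (÷-· f′ g u n) ⟩
  f 0 ℤ.* g (suc n) ℤ.+ (f (suc n) ℤ.- f 0 ℤ.* g (suc n))
    ≡⟨ ℤ.+-comm (f 0 ℤ.* g (suc n)) _ ⟩
  f (suc n) ℤ.- f 0 ℤ.* g (suc n) ℤ.+ f 0 ℤ.* g (suc n)
    ≡⟨ ℤ.+-assoc (f (suc n)) _ _ ⟩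
  f (suc n) ℤ.+ (ℤ.- (f 0 ℤ.* g (suc n)) ℤ.+ f 0 ℤ.* g (suc n))
    ≡⟨ cong (ℤ._+_ (f (suc n))) (ℤ.+-inverseˡ (f 0 ℤ.* g (suc n))) ⟩
  f (suc n) ℤ.+ 0ℤ
    ≡⟨ ℤ.+-identityʳ _ ⟩
  f (suc n) ∎
  where
  open ≡-Reasoning
  f′ : PowerSeries
  f′ k = f (suc k) ℤ.- f 0 ℤ.* g (suc k)

-- poch a N is the q-Pochhammer symbol (a; q)_N.
poch : PowerSeries → ℕ → PowerSeries
poch a zero    = 𝟙
poch a (suc N) = poch a N · (𝟙 ⊖ a · q^ N)

·-constant : ∀ {f g} → f 0 ≡ 1ℤ → g 0 ≡ 1ℤ → (f · g) 0 ≡ 1ℤ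
·-constant u v = cong (ℤ._+ 0ℤ) (cong₂ ℤ._*_ u v)

poch-q-constant : ∀ N → poch (q^ 1) N 0 ≡ 1ℤ
poch-q-constant zero    = refl
poch-q-constant (suc N) =
  ·-constant {poch (q^ 1) N} {𝟙 ⊖ q^ 1 · q^ N} (poch-q-constant N) refl

poch-q²-constant : ∀ N → (poch (q^ 1) N · poch (q^ 1) N) 0 ≡ 1ℤ
poch-q²-constant N =
  ·-constant {poch (q^ 1) N} {poch (q^ 1) N} (poch-q-constant N) (poch-q-constant N)

generatingFunction : (ℕ → ℕ) → PowerSeries
generatingFunction c m = + c m

-- Rows and columns of the Young diagram are indexed from 0; part ps i is 0 below
-- the last row.
_⊢_ : List ℕ → ℕ → Set
ps ⊢ n = Linked _≥_ ps × All (0 <_) ps × sum ps ≡ n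

part : List ℕ → ℕ → ℕ
part []       _       = 0
part (p ∷ ps) zero    = p
part (p ∷ ps) (suc i) = part ps i

columnLength : List ℕ → ℕ → ℕ
columnLength ps j = length (List.filter (j ℕ.<?_) ps)

Cell : List ℕ → ℕ → ℕ → Set
Cell ps i j = j < part ps i

hookLength : List ℕ → ℕ → ℕ → ℕ
hookLength ps i j = arm ℕ.+ leg ℕ.+ 1
  where
  arm leg : ℕ
  arm = part ps i ℕ.∸ suc j
  leg = columnLength ps j ℕ.∸ suc i

-- A largest square in a Young diagram may be taken at the top-left corner.
ContainsSquare : List ℕ → ℕ → Set
ContainsSquare ps s = ∀ i j → i < s → j < s → Cell ps i j

DurfeeSize : List ℕ → ℕ → Set
DurfeeSize ps d = ContainsSquare ps d × (∀ s → ContainsSquare ps s → s ≤ d)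

PrincipalHooksEven : List ℕ → Set
PrincipalHooksEven ps = ∀ i → Cell ps i i → 2 ∣ hookLength ps i i

IsEvenHookPartition : ℕ → ℕ → List ℕ → Set
IsEvenHookPartition d n ps = ps ⊢ n × DurfeeSize ps d × PrincipalHooksEven ps

EvenHookPartition : ℕ → ℕ → Set
EvenHookPartition d n = [ ps ∈ List ℕ ∣ IsEvenHookPartition d n ps ]

private
  cell-row : ∀ ps {i j} → Cell ps i j → i < length ps
  cell-row (p ∷ ps) {zero}  c = s≤s z≤n
  cell-row (p ∷ ps) {suc i} c = s≤s (cell-row ps c)

  containsSquare? : ∀ ps → Decidable (ContainsSquare ps)
  containsSquare? ps s = map′
    (λ h i j i< j< → h i< j<)
    (λ h {i} i< {j} j< → h i j i< j<)
    (ℕ.allUpTo? (λ i → ℕ.allUpTo? (λ j → j ℕ.<? part ps i) s) s)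

  durfeeSize? : ∀ ps → Decidable (DurfeeSize ps)
  durfeeSize? ps d = map′
    (λ (c , nc) → c , λ s cs → ℕ.≮⇒≥ λ d<s →
      nc λ i j i< j< → cs i j (ℕ.<-≤-trans i< d<s) (ℕ.<-≤-trans j< d<s))
    (λ (c , max) → c , λ c′ → ℕ.1+n≰n (max (suc d) c′))
    (containsSquare? ps d ×-dec ¬? (containsSquare? ps (suc d)))

  principalHooksEven? : Decidable PrincipalHooksEven
  principalHooksEven? ps = map′
    (λ h i c → h (cell-row ps c) c)
    (λ h {i} _ → h i)
    (ℕ.allUpTo? (λ i → (i ℕ.<? part ps i) →-dec (2 ∣? hookLength ps i i))
                (length ps))

  isEvenHookPartition? : ∀ d n → Decidable (IsEvenHookPartition d n)
  isEvenHookPartition? d n ps =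
    (Linked.linked? ℕ._≥?_ ps ×-dec All.all? (0 ℕ.<?_) ps ×-dec (sum ps ℕ.≟ n))
    ×-dec durfeeSize? ps d ×-dec principalHooksEven? ps

  boundedLists : ℕ → ℕ → List (List ℕ)
  boundedLists zero    b = [] ∷ []
  boundedLists (suc l) b =
    [] ∷ List.cartesianProductWith _∷_ (List.upTo (suc b)) (boundedLists l b)

  ∈-boundedLists : ∀ {l b ps} → length ps ≤ l → All (_≤ b) ps →
                   ps ∈ boundedLists l b
  ∈-boundedLists {zero}  {ps = []}     _       []       = here refl
  ∈-boundedLists {suc l} {ps = []}     _       []       = here refl
  ∈-boundedLists {suc l} {ps = p ∷ ps} (s≤s n) (b ∷ bs) =
    there (∈-cartesianProductWith⁺ _∷_ (∈-upTo⁺ (s≤s b)) (∈-boundedLists n bs))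

  length≤sum : ∀ {ps} → All (0 <_) ps → length ps ≤ sum ps
  length≤sum []       = z≤n
  length≤sum (p ∷ ps) = ℕ.+-mono-≤ p (length≤sum ps)

  parts≤sum : ∀ ps → All (_≤ sum ps) ps
  parts≤sum []       = []
  parts≤sum (p ∷ ps) = ℕ.m≤m+n p (sum ps) ∷
    All.map (λ x≤ → ℕ.≤-trans x≤ (ℕ.m≤n+m (sum ps) p)) (parts≤sum ps)

evenHookPartition-finite : ∀ d n → Finite (EvenHookPartition d n)
evenHookPartition-finite d n = refinement-finite
  (≡-dec ℕ._≟_) (isEvenHookPartition? d n) (boundedLists n n)
  λ { {ps} ((_ , pos , refl) , _) → ∈-boundedLists (length≤sum pos) (parts≤sum ps) }
  where open import Data.List.Properties using (≡-dec)

H : ℕ → ℕ → ℕ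
H d m = size (evenHookPartition-finite d (2 ℕ.* m))

-- A nonnegative part; true marks an overlined one.
OverPart : Set
OverPart = ℕ × Bool

-- An overlined entry of the row is not preceded by another entry of the same
-- value: only first occurrences may be overlined.
OnlyFirstOverlined : ∀ {d} → Vec OverPart d → Set
OnlyFirstOverlined = VecPairs.AllPairs λ (v , _) (w , o) → o ≡ true → v ≢ w

IsOverpartition : ∀ {d} → Vec OverPart d → Set
IsOverpartition row = VecLinked.Linked _≥_ (Vec.map proj₁ row)
                    × OnlyFirstOverlined row

Rows : ℕ → Set
Rows d = Vec ℕ d × Vec OverPart d

weight : ∀ {d} → Rows d → ℕ
weight {d} (top , bottom) = d ℕ.+ Vec.sum top ℕ.+ Vec.sum (Vec.map proj₁ bottom)

IsFrobeniusArray : ∀ d → ℕ → Rows d → Set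
IsFrobeniusArray d m (top , bottom) =
  VecLinked.Linked _>_ top × IsOverpartition bottom × weight (top , bottom) ≡ m

FrobeniusArray : ℕ → ℕ → Set
FrobeniusArray d m = [ rows ∈ Rows d ∣ IsFrobeniusArray d m rows ]

private
  isFrobeniusArray? : ∀ d m → Decidable (IsFrobeniusArray d m)
  isFrobeniusArray? d m (top , bottom) =
    VecLinked.linked? ℕ._>?_ top ×-dec
    (VecLinked.linked? ℕ._≥?_ (Vec.map proj₁ bottom) ×-dec
     VecPairs.allPairs?
       (λ (v , _) (w , o) → (o Bool.≟ true) →-dec ¬? (v ℕ.≟ w)) bottom) ×-dec
    (weight (top , bottom) ℕ.≟ m)

  vecs : ∀ {A : Set} → List A → ∀ d → List (Vec A d)
  vecs xs zero    = [] ∷ []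
  vecs xs (suc d) = List.cartesianProductWith _∷_ xs (vecs xs d)

  ∈-vecs : ∀ {A : Set} {xs : List A} {d} {v : Vec A d} →
           VecAll.All (_∈ xs) v → v ∈ vecs xs d
  ∈-vecs VecAll.[]         = here refl
  ∈-vecs (p VecAll.∷ ps) = ∈-cartesianProductWith⁺ _∷_ p (∈-vecs ps)

  bools : List Bool
  bools = true ∷ false ∷ []

  ∈-bools : ∀ o → o ∈ bools
  ∈-bools true  = here refl
  ∈-bools false = there (here refl)

  entries : ℕ → List ℕ
  entries b = List.upTo (suc b)

  overEntries : ℕ → List OverPart
  overEntries b = List.cartesianProduct (entries b) bools

  top-bounded : ∀ {d b} (v : Vec ℕ d) → Vec.sum v ≤ b → VecAll.All (_∈ entries b) v
  top-bounded []      _ = VecAll.[]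
  top-bounded (x ∷ v) s = ∈-upTo⁺ (s≤s (ℕ.m+n≤o⇒m≤o x s))
                          VecAll.∷ top-bounded v (ℕ.m+n≤o⇒n≤o x s)

  bottom-bounded : ∀ {d b} (v : Vec OverPart d) → Vec.sum (Vec.map proj₁ v) ≤ b →
                   VecAll.All (_∈ overEntries b) v
  bottom-bounded []            _ = VecAll.[]
  bottom-bounded ((x , o) ∷ v) s =
    ∈-cartesianProduct⁺ (∈-upTo⁺ (s≤s (ℕ.m+n≤o⇒m≤o x s))) (∈-bools o)
    VecAll.∷ bottom-bounded v (ℕ.m+n≤o⇒n≤o x s)

  candidateRows : ∀ d → ℕ → List (Rows d)
  candidateRows d m =
    List.cartesianProduct (vecs (entries m) d) (vecs (overEntries m) d)

  ∈-candidateRows : ∀ {d m} {rows : Rows d} → IsFrobeniusArray d m rows →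
                    rows ∈ candidateRows d m
  ∈-candidateRows {d} {rows = top , bottom} (_ , _ , refl) = ∈-cartesianProduct⁺
    (∈-vecs (top-bounded top
      (ℕ.≤-trans (ℕ.m≤n+m _ d) (ℕ.m≤m+n _ (Vec.sum (Vec.map proj₁ bottom))))))
    (∈-vecs (bottom-bounded bottom (ℕ.m≤n+m _ (d ℕ.+ Vec.sum top))))

frobeniusArray-finite : ∀ d m → Finite (FrobeniusArray d m)
frobeniusArray-finite d m = refinement-finite
  (Product.≡-dec (Vec.≡-dec ℕ._≟_) (Vec.≡-dec (Product.≡-dec ℕ._≟_ Bool._≟_)))
  (isFrobeniusArray? d m) (candidateRows d m) ∈-candidateRows

-- Counts overpartitions of m whose Frobenius representation has d columns, via the
-- bijection of overpartitions of m with Frobenius arrays of weight m.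
O : ℕ → ℕ → ℕ
O d m = size (frobeniusArray-finite d m)

{-# OPTIONS --safe #-}
module Submission where

-- Partitions with even principal hooks and Frobenius arrays with d columns are
-- both put in bijection with a bit together with pairs (xᵢ , yᵢ), 1 ≤ i ≤ d, and
-- bits εᵢ, i < d, of total weight Σ i (1 + xᵢ + yᵢ + εᵢ), where ε_d = 0.
-- On the hook side the arms drop by 2xᵢ + εᵢ + 1 and the legs by 2yᵢ + εᵢ + 1
-- from the i-th to the next principal hook, and the remaining bit decides which of
-- the innermost arm and leg is odd.  On the Frobenius side the top row drops by
-- xᵢ + 1 and the bottom row by yᵢ + εᵢ, with εᵢ marking an overline in column
-- i + 1 and the remaining bit an overline in column 1.  The i-th triple contributes
-- qⁱ (1 + qⁱ) / (1 - qⁱ)² for i < d and the last pair q^d / (1 - q^d)².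

open import Defs
open import Algebra.Bundles using (CommutativeMonoid)
open import Data.Bool.Base using (Bool; true; false; not)
import Data.Bool.Properties as Bool
open import Data.Empty using (⊥; ⊥-elim)
open import Data.Fin.Base using (Fin)
import Data.Fin.Permutation as Permutation
import Data.Fin.Properties as Fin
open import Data.Integer.Base as ℤ using (ℤ; +_; 0ℤ; 1ℤ; -1ℤ)
import Data.Integer.Properties as ℤ
import Data.Integer.Tactic.RingSolver as ℤ-Solver
open import Data.Irrelevant using ([_])
open import Data.List.Base using (List; []; _∷_; length; replicate; map; _++_)
import Data.List.Properties as List
open import Data.List.Relation.Unary.All using (All; []; _∷_)
open import Data.List.Relation.Unary.Linked as Linked using (Linked; []; [-]; _∷_)
open import Data.Nat.Base as ℕ
  using (ℕ; zero; suc; _≥_; _>_; _≤_; _<_; _+_; _∸_; z≤n; s≤s; z<s; s<s)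
open import Data.Nat.Combinatorics using (_C_; nC1≡n; nCk+nC[k+1]≡[n+1]C[k+1])
open import Data.Nat.Divisibility using (_∣_; _∤_; _∣?_; divides; ∣m+n∣m⇒∣n; m∣m*n)
open import Data.Nat.ListAction using (sum)
import Data.Nat.Properties as ℕ
import Data.Nat.Tactic.RingSolver as ℕ-Solver
open import Data.Product.Base using (Σ; ∃; _×_; _,_; proj₁; proj₂)
open import Data.Product.Function.NonDependent.Propositional using (_×-↔_)
import Data.Product.Properties as Product
open import Data.Refinement.Base using (Refinement-syntax; value; _,_)
open import Data.Sum.Base using (_⊎_; inj₁; inj₂; [_,_]′)
open import Data.Sum.Function.Propositional using (_⊎-↔_)
open import Data.Unit.Base using (⊤; tt)
open import Data.Vec.Base as Vec using (Vec; []; _∷_; head)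
import Data.Vec.Properties as Vec
open import Data.Vec.Relation.Unary.All as VecAll using ([]; _∷_)
open import Data.Vec.Relation.Unary.AllPairs using ([]; _∷_)
open import Data.Vec.Relation.Unary.Linked as VecLinked using ([]; [-]; _∷_)
open import Function.Base using (_∘_)
open import Function.Bundles using (_↔_; mk↔ₛ′; module Inverse)
open import Function.Definitions using (Injective)
open import Function.Properties.Inverse using (↔-sym; ↔-trans)
open import Level using (0ℓ)
open import Relation.Binary.Definitions using (DecidableEquality)
open import Relation.Binary.PropositionalEquality
import Relation.Binary.Reasoning.Setoid as SetoidReasoning
open import Relation.Nullary using (¬_; contradiction; yes; no)
open import Relation.Nullary.Decidable using (recompute)

-- Power series

infixl 6 _⊕_
infixl 7 _⋆_

_⊕_ : PowerSeries → PowerSeries → PowerSeries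
(f ⊕ g) n = f n ℤ.+ g n

_⋆_ : ℤ → PowerSeries → PowerSeries
(c ⋆ f) n = c ℤ.* f n

-- `(f · g) (suc n)` reduces to `f 0 * g (suc n) + (f ∘ suc · g) n`; the inductions on products
-- below rest on this unfolding.
·-cong : ∀ {f f′ g g′} → f ≗ f′ → g ≗ g′ → f · g ≗ f′ · g′
·-cong p q zero    = cong₂ (λ a b → a ℤ.* b ℤ.+ 0ℤ) (p 0) (q 0)
·-cong p q (suc n) =
  cong₂ ℤ._+_ (cong₂ ℤ._*_ (p 0) (q (suc n))) (·-cong (p ∘ suc) q n)

·-distribʳ-⊕ : ∀ f g h → (f ⊕ g) · h ≗ f · h ⊕ g · h
·-distribʳ-⊕ f g h zero    = lemma (f 0) (g 0) (h 0)
  where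
  lemma : ∀ a b c → (a ℤ.+ b) ℤ.* c ℤ.+ 0ℤ ≡ a ℤ.* c ℤ.+ 0ℤ ℤ.+ (b ℤ.* c ℤ.+ 0ℤ)
  lemma = ℤ-Solver.solve-∀
·-distribʳ-⊕ f g h (suc n) =
  trans (cong (ℤ._+_ ((f 0 ℤ.+ g 0) ℤ.* h (suc n))) (·-distribʳ-⊕ (f ∘ suc) (g ∘ suc) h n))
        (lemma (f 0) (g 0) (h (suc n)) _ _)
  where
  lemma : ∀ a b c x y →
    (a ℤ.+ b) ℤ.* c ℤ.+ (x ℤ.+ y) ≡ a ℤ.* c ℤ.+ x ℤ.+ (b ℤ.* c ℤ.+ y)
  lemma = ℤ-Solver.solve-∀

⋆-·-assoc : ∀ c f g → c ⋆ f · g ≗ c ⋆ (f · g)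
⋆-·-assoc c f g zero    = lemma c (f 0) (g 0)
  where
  lemma : ∀ a b c → a ℤ.* b ℤ.* c ℤ.+ 0ℤ ≡ a ℤ.* (b ℤ.* c ℤ.+ 0ℤ)
  lemma = ℤ-Solver.solve-∀
⋆-·-assoc c f g (suc n) =
  trans (cong (ℤ._+_ (c ℤ.* f 0 ℤ.* g (suc n))) (⋆-·-assoc c (f ∘ suc) g n))
        (lemma c (f 0) (g (suc n)) _)
  where
  lemma : ∀ a b c x → a ℤ.* b ℤ.* c ℤ.+ a ℤ.* x ≡ a ℤ.* (b ℤ.* c ℤ.+ x)
  lemma = ℤ-Solver.solve-∀

-- The tail of `f · g` unfolds to `f 0 ⋆ g′ ⊕ f′ · g`, over which the product with `h` distributes.
·-assoc : ∀ f g h → f · g · h ≗ f · (g · h)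
·-assoc f g h zero    = lemma (f 0) (g 0) (h 0)
  where
  lemma : ∀ a b c →
    (a ℤ.* b ℤ.+ 0ℤ) ℤ.* c ℤ.+ 0ℤ ≡ a ℤ.* (b ℤ.* c ℤ.+ 0ℤ) ℤ.+ 0ℤ
  lemma = ℤ-Solver.solve-∀
·-assoc f g h (suc n) = begin
  (f · g) 0 ℤ.* h (suc n) ℤ.+ ((f 0 ⋆ g′ ⊕ f′ · g) · h) n
    ≡⟨ cong (ℤ._+_ ((f · g) 0 ℤ.* h (suc n))) (begin
         ((f 0 ⋆ g′ ⊕ f′ · g) · h) n
           ≡⟨ ·-distribʳ-⊕ (f 0 ⋆ g′) (f′ · g) h n ⟩
         (f 0 ⋆ g′ · h) n ℤ.+ (f′ · g · h) n
           ≡⟨ cong₂ ℤ._+_ (⋆-·-assoc (f 0) g′ h n) (·-assoc f′ g h n) ⟩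
         f 0 ℤ.* (g′ · h) n ℤ.+ (f′ · (g · h)) n ∎) ⟩
  (f 0 ℤ.* g 0 ℤ.+ 0ℤ) ℤ.* h (suc n) ℤ.+ (f 0 ℤ.* (g′ · h) n ℤ.+ (f′ · (g · h)) n)
    ≡⟨ lemma (f 0) (g 0) (h (suc n)) _ _ ⟩
  f 0 ℤ.* (g · h) (suc n) ℤ.+ (f′ · (g · h)) n ∎
  where
  open ≡-Reasoning
  f′ g′ : PowerSeries
  f′ = f ∘ suc
  g′ = g ∘ suc
  lemma : ∀ a b c x y → (a ℤ.* b ℤ.+ 0ℤ) ℤ.* c ℤ.+ (a ℤ.* x ℤ.+ y)
                      ≡ a ℤ.* (b ℤ.* c ℤ.+ x) ℤ.+ y
  lemma = ℤ-Solver.solve-∀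

-- Splits off the last summand, where the unfolding of `·` splits off the first; commutativity
-- exchanges the two.
·-suc : ∀ f g n → (f · g) (suc n) ≡ (f · (g ∘ suc)) n ℤ.+ f (suc n) ℤ.* g 0
·-suc f g zero    = lemma (f 0) (g 1) (f 1) (g 0)
  where
  lemma : ∀ a b c d → a ℤ.* b ℤ.+ (c ℤ.* d ℤ.+ 0ℤ) ≡ a ℤ.* b ℤ.+ 0ℤ ℤ.+ c ℤ.* d
  lemma = ℤ-Solver.solve-∀
·-suc f g (suc n) =
  trans (cong (ℤ._+_ (f 0 ℤ.* g (suc (suc n)))) (·-suc (f ∘ suc) g n))
        (sym (ℤ.+-assoc (f 0 ℤ.* g (suc (suc n))) _ _))

·-comm : ∀ f g → f · g ≗ g · f
·-comm f g zero    = cong (ℤ._+ 0ℤ) (ℤ.*-comm (f 0) (g 0))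
·-comm f g (suc n) = begin
  f 0 ℤ.* g (suc n) ℤ.+ (f ∘ suc · g) n
    ≡⟨ cong₂ ℤ._+_ (ℤ.*-comm (f 0) (g (suc n))) (·-comm (f ∘ suc) g n) ⟩
  g (suc n) ℤ.* f 0 ℤ.+ (g · (f ∘ suc)) n
    ≡⟨ ℤ.+-comm (g (suc n) ℤ.* f 0) _ ⟩
  (g · (f ∘ suc)) n ℤ.+ g (suc n) ℤ.* f 0
    ≡⟨ ·-suc g f n ⟨
  (g · f) (suc n) ∎
  where open ≡-Reasoning

·-zeroˡ : ∀ f → const 0ℤ · f ≗ const 0ℤ
·-zeroˡ f n = begin
  (const 0ℤ · f) n      ≡⟨ ·-cong {g = f} const-0 (λ _ → refl) n ⟩
  (0ℤ ⋆ const 0ℤ · f) n ≡⟨ ⋆-·-assoc 0ℤ (const 0ℤ) f n ⟩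
  0ℤ                    ≡⟨ const-0 n ⟨
  const 0ℤ n            ∎
  where
  open ≡-Reasoning
  const-0 : const 0ℤ ≗ λ _ → 0ℤ
  const-0 zero    = refl
  const-0 (suc _) = refl

·-identityˡ : ∀ f → 𝟙 · f ≗ f
·-identityˡ f zero    = lemma (f 0)
  where
  lemma : ∀ a → 1ℤ ℤ.* a ℤ.+ 0ℤ ≡ a
  lemma = ℤ-Solver.solve-∀
·-identityˡ f (suc n) =
  trans (cong (ℤ._+_ (1ℤ ℤ.* f (suc n)))
          (trans (·-cong {g = f} tail-𝟙 (λ _ → refl) n) (·-zeroˡ f n)))
        -- `const 0ℤ n` is stuck for a variable `n`, so it is traded back for `𝟙 (suc n)`, which
        -- reduces to `0ℤ`.
        (trans (cong (ℤ._+_ (1ℤ ℤ.* f (suc n))) (sym (tail-𝟙 n))) (lemma (f (suc n))))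
  where
  tail-𝟙 : 𝟙 ∘ suc ≗ const 0ℤ
  tail-𝟙 zero    = refl
  tail-𝟙 (suc _) = refl
  lemma : ∀ a → 1ℤ ℤ.* a ℤ.+ 0ℤ ≡ a
  lemma = ℤ-Solver.solve-∀

·-identityʳ : ∀ f → f · 𝟙 ≗ f
·-identityʳ f n = trans (·-comm f 𝟙 n) (·-identityˡ f n)

-- Lets the commutative monoid solver regroup the long products of the closed form.
·-𝟙-commutativeMonoid : CommutativeMonoid 0ℓ 0ℓ
·-𝟙-commutativeMonoid = record
  { Carrier = PowerSeries
  ; _≈_     = _≗_
  ; _∙_     = _·_
  ; ε       = 𝟙
  ; isCommutativeMonoid = record
    { isMonoid = record
      { isSemigroup = record
        { isMagma = record
          { isEquivalence = record
            { refl = λ _ → refl ; sym = λ p n → sym (p n) ; trans = λ p q n → trans (p n) (q n) }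
          ; ∙-cong = ·-cong
          }
        ; assoc = ·-assoc
        }
      ; identity = ·-identityˡ , ·-identityʳ
      }
    ; comm = ·-comm
    }
  }

⊝-· : ∀ f g → ⊝ f · g ≗ ⊝ (f · g)
⊝-· f g n = begin
  (⊝ f · g) n        ≡⟨ ·-cong {g = g} (λ k → sym (ℤ.-1*i≡-i (f k))) (λ _ → refl) n ⟩
  (-1ℤ ⋆ f · g) n    ≡⟨ ⋆-·-assoc -1ℤ f g n ⟩
  -1ℤ ℤ.* (f · g) n  ≡⟨ ℤ.-1*i≡-i _ ⟩
  ℤ.- (f · g) n      ∎
  where open ≡-Reasoning

·-distribʳ-⊖ : ∀ f g h → (f ⊖ g) · h ≗ f · h ⊖ g · h
·-distribʳ-⊖ f g h n =
  trans (·-distribʳ-⊕ f (⊝ g) h n) (cong (ℤ._+_ ((f · h) n)) (⊝-· g h n))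

-- Long division is forced: `g 0 ≡ 1ℤ` fixes the leading coefficient of `h`, and the tail of `h`
-- times `g` is the remainder on which the division recurses.
÷-unique : ∀ f g h (u : g 0 ≡ 1ℤ) → h · g ≗ f → h ≗ f ÷ g [ u ]
÷-unique f g h u eq n = go h f eq n
  where
  open ≡-Reasoning
  leading : ∀ h f → h · g ≗ f → h 0 ≡ f 0
  leading h f eq = begin
    h 0                ≡⟨ ℤ.*-identityʳ (h 0) ⟨
    h 0 ℤ.* 1ℤ         ≡⟨ cong (h 0 ℤ.*_) u ⟨
    h 0 ℤ.* g 0        ≡⟨ ℤ.+-identityʳ _ ⟨
    (h · g) 0          ≡⟨ eq 0 ⟩
    f 0                ∎
  lemma : ∀ a x → x ≡ a ℤ.+ x ℤ.- a
  lemma = ℤ-Solver.solve-∀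
  go : ∀ h f → h · g ≗ f → h ≗ f ÷ g [ u ]
  go h f eq zero    = leading h f eq
  go h f eq (suc n) = go (h ∘ suc) _ (λ k → begin
    (h ∘ suc · g) k
      ≡⟨ lemma (h 0 ℤ.* g (suc k)) _ ⟩
    (h · g) (suc k) ℤ.- h 0 ℤ.* g (suc k)
      ≡⟨ cong₂ (λ x y → x ℤ.- y ℤ.* g (suc k)) (eq (suc k)) (leading h f eq) ⟩
    f (suc k) ℤ.- f 0 ℤ.* g (suc k) ∎) n

-- Counting weighted sets

Count : Set → ℤ → Set
Count A z = ∃ λ k → z ≡ + k × Fin k ↔ A

count-resp : ∀ {A B z} → A ↔ B → Count A z → Count B z
count-resp A↔B (k , eq , e) = k , eq , ↔-trans e A↔B

count-unique : ∀ {A y z} → Count A y → Count A z → y ≡ z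
count-unique (_ , refl , e) (_ , refl , e′) =
  cong +_ (Permutation.↔⇒≡ (↔-trans e (↔-sym e′)))

count-size : ∀ {A z} (fin : Finite A) → Count A z → + size fin ≡ z
count-size fin (k , refl , e) = cong +_ (size-unique fin e)

count-⊎ : ∀ {A B y z} → Count A y → Count B z → Count (A ⊎ B) (y ℤ.+ z)
count-⊎ (k , refl , e) (l , refl , e′) =
  k ℕ.+ l , sym (ℤ.pos-+ k l) , ↔-trans Fin.+↔⊎ (e ⊎-↔ e′)

count-× : ∀ {A B y z} → Count A y → Count B z → Count (A × B) (y ℤ.* z)
count-× (k , refl , e) (l , refl , e′) =
  k ℕ.* l , sym (ℤ.pos-* k l) , ↔-trans Fin.*↔× (e ×-↔ e′)

count-empty : ∀ {A : Set} → ¬ A → Count A 0ℤ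
count-empty ¬a = 0 , refl , mk↔ₛ′ (λ ()) (λ a → ⊥-elim (¬a a))
  (λ a → ⊥-elim (¬a a)) (λ ())

count-singleton : ∀ {A : Set} (a : A) → (∀ b → a ≡ b) → Count A 1ℤ
count-singleton a unique =
  1 , refl , ↔-trans Fin.1↔⊤ (mk↔ₛ′ (λ _ → a) (λ _ → tt) unique (λ _ → refl))

-- A refinement hides the proof of P b, so a preimage of b is found by searching
-- the finite set A; its existence may then be used irrelevantly.
count-refinement : ∀ {A B : Set} {P : B → Set} {z} → DecidableEquality B → (f : A → B) →
  (∀ a → P (f a)) → Injective _≡_ _≡_ f → (∀ {b} → P b → ∃ λ a → f a ≡ b) →
  Count A z → Count [ b ∈ B ∣ P b ] z
count-refinement {A} {B} {P} _≟_ f P-f f-injective f-onto (k , eq , e) = k , eq , mk↔ₛ′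
  (λ i → f (to i) , [ P-f (to i) ])
  (λ u → proj₁ (search u))
  (λ u → value-injective (proj₂ (search u)))
  -- The search might return an index other than `i`; injectivity of `f` and of `to` identifies the
  -- two.
  (λ i → trans (sym (strictlyInverseʳ _))
    (trans (cong from (f-injective (proj₂ (search (f (to i) , [ P-f (to i) ])))))
           (strictlyInverseʳ i)))
  where
  open Inverse e
  preimage : ∀ {b} → P b → ∃ λ i → f (to i) ≡ b
  preimage p with f-onto p
  ... | a , refl = from a , cong f (strictlyInverseˡ a)
  search : (u : [ b ∈ B ∣ P b ]) → ∃ λ i → f (to i) ≡ value u
  search (b , [ p ]) = recompute (Fin.any? (λ i → f (to i) ≟ b)) (preimage p)
  value-injective : ∀ {u v : [ b ∈ B ∣ P b ]} → value u ≡ value v → u ≡ v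
  value-injective refl = refl

-- Generating functions of weighted sets.

Fiber : ∀ {A : Set} → (A → ℕ) → ℕ → Set
Fiber {A} w n = ∃ λ a → w a ≡ n

fiber-≡ : ∀ {A : Set} {w : A → ℕ} {n} {u v : Fiber w n} → proj₁ u ≡ proj₁ v → u ≡ v
fiber-≡ {u = a , p} {.a , q} refl = cong (a ,_) (ℕ.≡-irrelevant p q)

HasGF : ∀ {A : Set} → (A → ℕ) → PowerSeries → Set
HasGF w f = ∀ n → Count (Fiber w n) (f n)

-- Turns bijections into identities of series: counting one weighted set in two ways yields `q^-+`
-- and `geometric-recurrence`.
hasGF-unique : ∀ {A : Set} {w : A → ℕ} {f g} → HasGF w f → HasGF w g → f ≗ g
hasGF-unique p q n = count-unique (p n) (q n)

hasGF-resp : ∀ {A B : Set} {v : A → ℕ} {w : B → ℕ} {f} (e : A ↔ B) →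
  (∀ a → w (Inverse.to e a) ≡ v a) → HasGF v f → HasGF w f
hasGF-resp {v = v} {w} e eq p n = count-resp (mk↔ₛ′
  (λ (a , q) → to a , trans (eq a) q)
  (λ (b , q) → from b , trans (sym (eq (from b))) (trans (cong w (strictlyInverseˡ b)) q))
  (λ (b , _) → fiber-≡ (strictlyInverseˡ b))
  (λ (a , _) → fiber-≡ (strictlyInverseʳ a))) (p n)
  where open Inverse e

hasGF-⊎ : ∀ {A B : Set} {v : A → ℕ} {w : B → ℕ} {f g} → HasGF v f → HasGF w g →
  HasGF [ v , w ]′ (f ⊕ g)
hasGF-⊎ p q n = count-resp (mk↔ₛ′
  (λ { (inj₁ (a , r)) → inj₁ a , r ; (inj₂ (b , r)) → inj₂ b , r })
  (λ { (inj₁ a , r) → inj₁ (a , r) ; (inj₂ b , r) → inj₂ (b , r) })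
  (λ { (inj₁ a , r) → refl ; (inj₂ b , r) → refl })
  (λ { (inj₁ (a , r)) → refl ; (inj₂ (b , r)) → refl })) (count-⊎ (p n) (q n))

Convolution : (F G : ℕ → Set) → ℕ → Set
Convolution F G n = Σ (ℕ × ℕ) λ (i , j) → i ℕ.+ j ≡ n × F i × G j

-- The induction follows the unfolding of `·`: pairs with first index 0 are split off, and the rest
-- form a convolution with `F` shifted by one.
count-convolution : ∀ {F G f g} → (∀ i → Count (F i) (f i)) → (∀ j → Count (G j) (g j)) →
  ∀ n → Count (Convolution F G n) ((f · g) n)
count-convolution {F} {G} {f} {g} p q zero = count-resp
  (mk↔ₛ′ {A = F 0 × G 0} {B = Convolution F G 0}
         (λ (x , y) → (0 , 0) , refl , x , y)
         (λ { ((zero , zero) , refl , x , y) → x , y })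
         (λ { ((zero , zero) , refl , x , y) → refl })
         (λ _ → refl))
  (subst (Count (F 0 × G 0)) (sym (ℤ.+-identityʳ (f 0 ℤ.* g 0))) (count-× (p 0) (q 0)))
count-convolution {F} {G} p q (suc n) = count-resp
  (mk↔ₛ′ (λ { (inj₁ (x , y)) → (0 , suc n) , refl , x , y
            ; (inj₂ ((i , j) , r , x , y)) → (suc i , j) , cong suc r , x , y })
         (λ { ((zero , _) , refl , x , y) → inj₁ (x , y)
            ; ((suc i , j) , refl , x , y) → inj₂ ((i , j) , refl , x , y) })
         (λ { ((zero , _) , refl , x , y) → refl
            ; ((suc i , j) , refl , x , y) → refl })
         (λ { (inj₁ (x , y)) → refl
            ; (inj₂ ((i , j) , refl , x , y)) → refl }))
  (count-⊎ (count-× (p 0) (q (suc n))) (count-convolution {F ∘ suc} {G} (p ∘ suc) q n))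

infixr 7 _⊠_

_⊠_ : ∀ {A B : Set} → (A → ℕ) → (B → ℕ) → A × B → ℕ
(v ⊠ w) (a , b) = v a ℕ.+ w b

hasGF-× : ∀ {A B : Set} {v : A → ℕ} {w : B → ℕ} {f g} → HasGF v f → HasGF w g →
  HasGF (v ⊠ w) (f · g)
hasGF-× {v = v} {w} p q n = count-resp (mk↔ₛ′ {B = Fiber (v ⊠ w) n}
  (λ { (_ , r , (a , refl) , (b , refl)) → (a , b) , r })
  (λ { ((a , b) , r) → (v a , w b) , r , (a , refl) , (b , refl) })
  (λ _ → refl)
  (λ { (_ , r , (a , refl) , (b , refl)) → refl })) (count-convolution p q n)

hasGF-point : ∀ k → HasGF {⊤} (λ _ → k) (q^ k)
hasGF-point k n with k ℕ.≟ n
... | yes k≡n = count-singleton (tt , k≡n) (λ _ → fiber-≡ refl)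
... | no  k≢n = count-empty (k≢n ∘ proj₂)

hasGF-shift : ∀ {A : Set} {w : A → ℕ} {f} k → HasGF w f → HasGF (λ a → k ℕ.+ w a) (q^ k · f)
hasGF-shift {A} {w} k p = hasGF-resp {v = (λ _ → k) ⊠ w}
  (mk↔ₛ′ {A = ⊤ × A} proj₂ (tt ,_) (λ _ → refl) (λ _ → refl)) (λ _ → refl)
  (hasGF-× (hasGF-point k) p)

q^0≗𝟙 : q^ 0 ≗ 𝟙
q^0≗𝟙 zero    = refl
q^0≗𝟙 (suc n) = refl

q^-+ : ∀ a b → q^ a · q^ b ≗ q^ (a ℕ.+ b)
q^-+ a b = hasGF-unique
  (hasGF-shift a (hasGF-point b)) (hasGF-point (a ℕ.+ b))

bit : Bool → ℕ
bit false = 0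
bit true  = 1

⊤⊎⊤↔Bool : (⊤ ⊎ ⊤) ↔ Bool
⊤⊎⊤↔Bool = mk↔ₛ′ (λ { (inj₁ _) → false ; (inj₂ _) → true })
                 (λ { false → inj₁ tt ; true → inj₂ tt })
                 (λ { false → refl ; true → refl })
                 (λ { (inj₁ _) → refl ; (inj₂ _) → refl })

hasGF-bit : ∀ k → HasGF (λ o → k ℕ.* bit o) (q^ 0 ⊕ q^ k)
hasGF-bit k = hasGF-resp ⊤⊎⊤↔Bool
  (λ { (inj₁ _) → ℕ.*-zeroʳ k ; (inj₂ _) → ℕ.*-identityʳ k })
  (hasGF-⊎ (hasGF-point 0) (hasGF-point k))

-- This is 1 / (1 - q^k) for positive `k`, given by coefficients so that it counts the multiples of
-- `k`.
geometric : ℕ → PowerSeries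
geometric k n with k ∣? n
... | yes _ = 1ℤ
... | no  _ = 0ℤ

hasGF-multiples : ∀ k → HasGF (suc k ℕ.*_) (geometric (suc k))
hasGF-multiples k n with suc k ∣? n
... | yes (divides c eq) = count-singleton (c , trans (ℕ.*-comm (suc k) c) (sym eq))
  λ (x , eq′) → fiber-≡ (ℕ.*-cancelˡ-≡ c x (suc k)
    (trans (ℕ.*-comm (suc k) c) (trans (sym eq) (sym eq′))))
... | no  ∤ = count-empty λ (x , eq) → ∤ (divides x (trans (sym eq) (ℕ.*-comm (suc k) x)))

-- A multiplier is zero or a successor, which splits the multiples into 0 and a shifted copy of all
-- of them.
geometric-recurrence : ∀ k →
  geometric (suc k) ≗ q^ 0 ⊕ q^ (suc k) · geometric (suc k)
geometric-recurrence k = hasGF-unique (hasGF-multiples k) (hasGF-resp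
  (mk↔ₛ′ (λ { (inj₁ _) → zero ; (inj₂ x) → suc x })
         (λ { zero → inj₁ tt ; (suc x) → inj₂ x })
         (λ { zero → refl ; (suc x) → refl })
         (λ { (inj₁ _) → refl ; (inj₂ x) → refl }))
  (λ { (inj₁ _) → ℕ.*-zeroʳ (suc k) ; (inj₂ x) → ℕ.*-suc (suc k) x })
  (hasGF-⊎ (hasGF-point 0) (hasGF-shift (suc k) (hasGF-multiples k))))

-- The weighted set common to both sides

-- `Code n` describes n + 1 columns. A bit belongs to the passage from its column to the next, so
-- the last column has none.
Code : ℕ → Set
Code zero    = ℕ × ℕ
Code (suc n) = ((ℕ × ℕ) × Bool) × Code n

-- This is k (1 + x + y), expanded into the shape that a shift and a product of weighted sets
-- produce.
pairWeight : ℕ → ℕ × ℕ → ℕ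
pairWeight k (x , y) = k ℕ.+ (k ℕ.* x ℕ.+ k ℕ.* y)

-- The columns of a code carry the multiplicities k, k + 1, …, k + n.
codeWeight : ∀ n → ℕ → Code n → ℕ
codeWeight zero    k c             = pairWeight k c
codeWeight (suc n) k ((xy , ε) , c) =
  (pairWeight k xy ℕ.+ k ℕ.* bit ε) ℕ.+ codeWeight n (suc k) c

pairGF : ℕ → PowerSeries
pairGF k = q^ k · (geometric k · geometric k)

codeGF : ℕ → ℕ → PowerSeries
codeGF zero    k = pairGF k
codeGF (suc n) k = pairGF k · (q^ 0 ⊕ q^ k) · codeGF n (suc k)

hasGF-pair : ∀ k → HasGF (pairWeight (suc k)) (pairGF (suc k))
hasGF-pair k = hasGF-shift (suc k) (hasGF-× (hasGF-multiples k) (hasGF-multiples k))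

hasGF-code : ∀ n k → HasGF (codeWeight n (suc k)) (codeGF n (suc k))
hasGF-code zero    k = hasGF-pair k
hasGF-code (suc n) k =
  hasGF-× (hasGF-× (hasGF-pair k) (hasGF-bit (suc k))) (hasGF-code n (suc k))

markedWeight : ∀ n → Bool × Code n → ℕ
markedWeight n (_ , c) = codeWeight n 1 c

-- The extra bit has weight 0, so its series is `q^ 0 ⊕ q^ 0`, the factor 2 of the formula.
hasGF-marked : ∀ n → HasGF (markedWeight n) (const (+ 2) · codeGF n 1)
hasGF-marked n m = subst (Count _) (·-cong {g = codeGF n 1} two (λ _ → refl) m)
  (hasGF-× (hasGF-bit 0) (hasGF-code n 0) m)
  where
  two : q^ 0 ⊕ q^ 0 ≗ const (+ 2)
  two zero    = refl
  two (suc _) = refl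

-- Closed form of the generating function of codes.

geometricProduct : ℕ → PowerSeries
geometricProduct zero    = 𝟙
geometricProduct (suc N) = geometricProduct N · geometric (suc N)

open import Algebra.Solver.CommutativeMonoid ·-𝟙-commutativeMonoid
  using (solve; _⊜_) renaming (_⊕_ to _∙_)

private
  module PS = CommutativeMonoid ·-𝟙-commutativeMonoid
  module ≗-Reasoning = SetoidReasoning PS.setoid

poch-q-factor : ∀ N → 𝟙 ⊖ q^ 1 · q^ N ≗ 𝟙 ⊖ q^ (suc N)
poch-q-factor N n = cong (λ c → 𝟙 n ℤ.- c) (q^-+ 1 N n)

poch-⊝q-factor : ∀ N → 𝟙 ⊖ ⊝ (q^ 1) · q^ N ≗ q^ 0 ⊕ q^ (suc N)
poch-⊝q-factor N n = cong₂ ℤ._+_ (sym (q^0≗𝟙 n))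
  (trans (cong ℤ.-_ (trans (⊝-· (q^ 1) (q^ N) n) (cong ℤ.-_ (q^-+ 1 N n))))
         (ℤ.neg-involutive _))

geometric-inverse : ∀ k → (𝟙 ⊖ q^ (suc k)) · geometric (suc k) ≗ 𝟙
geometric-inverse k n = begin
  ((𝟙 ⊖ q^ (suc k)) · r) n
    ≡⟨ ·-distribʳ-⊖ 𝟙 (q^ (suc k)) r n ⟩
  (𝟙 · r) n ℤ.- (q^ (suc k) · r) n
    ≡⟨ cong (ℤ._- (q^ (suc k) · r) n) (trans (·-identityˡ r n) (geometric-recurrence k n)) ⟩
  (q^ 0) n ℤ.+ (q^ (suc k) · r) n ℤ.- (q^ (suc k) · r) n
    ≡⟨ cancel _ _ ⟩
  (q^ 0) n
    ≡⟨ q^0≗𝟙 n ⟩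
  𝟙 n ∎
  where
  open ≡-Reasoning
  r : PowerSeries
  r = geometric (suc k)
  cancel : ∀ a b → a ℤ.+ b ℤ.- b ≡ a
  cancel = ℤ-Solver.solve-∀

geometricProduct-inverse : ∀ N → geometricProduct N · poch (q^ 1) N ≗ 𝟙
geometricProduct-inverse zero    = ·-identityˡ 𝟙
geometricProduct-inverse (suc N) = begin
  R · r · (P · (𝟙 ⊖ q^ 1 · q^ N))
    ≈⟨ ·-cong {f = R · r} (λ _ → refl) (·-cong {f = P} (λ _ → refl) (poch-q-factor N)) ⟩
  R · r · (P · (𝟙 ⊖ q^ (suc N)))
    ≈⟨ solve 4 (λ R r P s → (R ∙ r) ∙ (P ∙ s) ⊜ (R ∙ P) ∙ (s ∙ r)) (λ _ → refl)
         R r P (𝟙 ⊖ q^ (suc N)) ⟩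
  R · P · ((𝟙 ⊖ q^ (suc N)) · r)
    ≈⟨ ·-cong (geometricProduct-inverse N) (geometric-inverse N) ⟩
  𝟙 · 𝟙
    ≈⟨ ·-identityˡ 𝟙 ⟩
  𝟙 ∎
  where
  open ≗-Reasoning
  R r P : PowerSeries
  R = geometricProduct N
  r = geometric (suc N)
  P = poch (q^ 1) N

-- Pascal's rule for triangular numbers, with `suc k C 1` equal to `suc k`.
q^-triangular : ∀ k → q^ (suc k C 2) · q^ (suc k) ≗ q^ (suc (suc k) C 2)
q^-triangular k n = trans (q^-+ (suc k C 2) (suc k) n) (cong (λ e → (q^ e) n) eq)
  where
  eq : suc k C 2 ℕ.+ suc k ≡ suc (suc k) C 2
  eq = trans (ℕ.+-comm (suc k C 2) (suc k))
    (trans (cong (ℕ._+ (suc k C 2)) (sym (nC1≡n (suc k)))) (nCk+nC[k+1]≡[n+1]C[k+1] (suc k) 1))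

-- The series of `k` columns of multiplicities 1, ..., k that all carry a bit: the product of the
-- q^i (1 + q^i) / (1 - q^i)^2.
completeGF : ℕ → PowerSeries
completeGF k =
  q^ (suc k C 2) · poch (⊝ (q^ 1)) k · (geometricProduct k · geometricProduct k)

completeGF-suc : ∀ k →
  completeGF k · (pairGF (suc k) · (q^ 0 ⊕ q^ (suc k))) ≗ completeGF (suc k)
completeGF-suc k = begin
  t · p · (R · R) · (q^ (suc k) · (r · r) · s)
    ≈⟨ solve 6 (λ t p R q r s →
         ((t ∙ p) ∙ (R ∙ R)) ∙ ((q ∙ (r ∙ r)) ∙ s)
           ⊜ ((t ∙ q) ∙ (p ∙ s)) ∙ ((R ∙ r) ∙ (R ∙ r))) (λ _ → refl)
         t p R (q^ (suc k)) r s ⟩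
  t · q^ (suc k) · (p · s) · (R · r · (R · r))
    ≈⟨ ·-cong {g = R · r · (R · r)} (·-cong (q^-triangular k)
         (·-cong {f = p} (λ _ → refl) (PS.sym {𝟙 ⊖ ⊝ (q^ 1) · q^ k} (poch-⊝q-factor k)))) (λ _ → refl) ⟩
  completeGF (suc k) ∎
  where
  open ≗-Reasoning
  t p R r s : PowerSeries
  t = q^ (suc k C 2)
  p = poch (⊝ (q^ 1)) k
  R = geometricProduct k
  r = geometric (suc k)
  s = q^ 0 ⊕ q^ (suc k)

-- The first `k` columns are already in closed form, and the induction absorbs the others one at a
-- time. The last column has no bit, so `poch` stops one factor before `geometricProduct`.
completeGF-codeGF : ∀ n k → completeGF k · codeGF n (suc k)
  ≗ q^ (suc (suc (k ℕ.+ n)) C 2) · poch (⊝ (q^ 1)) (k ℕ.+ n)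
    · (geometricProduct (suc (k ℕ.+ n)) · geometricProduct (suc (k ℕ.+ n)))
completeGF-codeGF zero k rewrite ℕ.+-identityʳ k = begin
  t · p · (R · R) · (q^ (suc k) · (r · r))
    ≈⟨ solve 5 (λ t p R q r →
         ((t ∙ p) ∙ (R ∙ R)) ∙ (q ∙ (r ∙ r))
           ⊜ ((t ∙ q) ∙ p) ∙ ((R ∙ r) ∙ (R ∙ r))) (λ _ → refl)
         t p R (q^ (suc k)) r ⟩
  t · q^ (suc k) · p · (R · r · (R · r))
    ≈⟨ ·-cong {g = R · r · (R · r)} (·-cong {g = p} (q^-triangular k) (λ _ → refl)) (λ _ → refl) ⟩
  q^ (suc (suc k) C 2) · p · (R · r · (R · r)) ∎
  where
  open ≗-Reasoning
  t p R r : PowerSeries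
  t = q^ (suc k C 2)
  p = poch (⊝ (q^ 1)) k
  R = geometricProduct k
  r = geometric (suc k)
completeGF-codeGF (suc n) k rewrite ℕ.+-suc k n = begin
  completeGF k · (column · codeGF n (suc (suc k)))
    ≈⟨ ·-assoc (completeGF k) column (codeGF n (suc (suc k))) ⟨
  completeGF k · column · codeGF n (suc (suc k))
    ≈⟨ ·-cong {g = codeGF n (suc (suc k))} (completeGF-suc k) (λ _ → refl) ⟩
  completeGF (suc k) · codeGF n (suc (suc k))
    ≈⟨ completeGF-codeGF n (suc k) ⟩
  _ ∎
  where
  open ≗-Reasoning
  column : PowerSeries
  column = pairGF (suc k) · (q^ 0 ⊕ q^ (suc k))

codeGF-closed : ∀ n → codeGF n 1
  ≗ q^ (suc (suc n) C 2) · poch (⊝ (q^ 1)) n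
    · (geometricProduct (suc n) · geometricProduct (suc n))
codeGF-closed n = begin
  codeGF n 1               ≈⟨ ·-identityˡ (codeGF n 1) ⟨
  𝟙 · codeGF n 1           ≈⟨ ·-cong {g = codeGF n 1} completeGF-0 (λ _ → refl) ⟨
  completeGF 0 · codeGF n 1 ≈⟨ completeGF-codeGF n 0 ⟩
  _ ∎
  where
  open ≗-Reasoning
  completeGF-0 : completeGF 0 ≗ 𝟙
  completeGF-0 = begin
    q^ 0 · 𝟙 · (𝟙 · 𝟙) ≈⟨ ·-cong (·-identityʳ (q^ 0)) (·-identityˡ 𝟙) ⟩
    q^ 0 · 𝟙           ≈⟨ ·-identityʳ (q^ 0) ⟩
    q^ 0               ≈⟨ q^0≗𝟙 ⟩
    𝟙 ∎

-- By uniqueness of the quotient it is enough to multiply by the squared (q; q)_(n+1), which cancels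
-- the squared `geometricProduct`.
marked-formula : ∀ n → const (+ 2) · codeGF n 1
  ≗ const (+ 2) · q^ ((suc n ℕ.+ 1) C 2) · poch (⊝ (q^ 1)) n
      ÷ (poch (q^ 1) (suc n) · poch (q^ 1) (suc n)) [ poch-q²-constant (suc n) ]
marked-formula n rewrite ℕ.+-comm n 1 =
  ÷-unique _ (P · P) (two · codeGF n 1) (poch-q²-constant (suc n)) (begin
    two · codeGF n 1 · (P · P)
      ≈⟨ ·-cong {g = P · P} (·-cong {f = two} (λ _ → refl) (codeGF-closed n)) (λ _ → refl) ⟩
    two · (t · p · (R · R)) · (P · P)
      ≈⟨ solve 5 (λ c t p R P →
           (c ∙ ((t ∙ p) ∙ (R ∙ R))) ∙ (P ∙ P) ⊜ ((c ∙ t) ∙ p) ∙ ((R ∙ P) ∙ (R ∙ P)))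
           (λ _ → refl) two t p R P ⟩
    two · t · p · (R · P · (R · P))
      ≈⟨ ·-cong {f = two · t · p} (λ _ → refl)
           (·-cong (geometricProduct-inverse (suc n)) (geometricProduct-inverse (suc n))) ⟩
    two · t · p · (𝟙 · 𝟙)
      ≈⟨ ·-cong {f = two · t · p} (λ _ → refl) (·-identityˡ 𝟙) ⟩
    two · t · p · 𝟙
      ≈⟨ ·-identityʳ (two · t · p) ⟩
    two · t · p ∎)
  where
  open ≗-Reasoning
  two t p P R : PowerSeries
  two = const (+ 2)
  t   = q^ (suc (suc n) C 2)
  p   = poch (⊝ (q^ 1)) n
  P   = poch (q^ 1) (suc n)
  R   = geometricProduct (suc n)

-- The weight of a code with all multiplicities 1. It is half the first principal hook length of the
-- decoded partition, and the weight of the first column of the array.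
height : ∀ n → Code n → ℕ
height zero    (x , y)                 = suc (x ℕ.+ y)
height (suc n) (((x , y) , ε) , c) = suc (x ℕ.+ y ℕ.+ bit ε) ℕ.+ height n c

-- Prepending a column raises the multiplicities of all later ones; the increase is what the new
-- first hook or array column inherits from the previous one.
codeWeight-suc : ∀ n k c → codeWeight n (suc k) c ≡ codeWeight n k c ℕ.+ height n c
codeWeight-suc zero    k (x , y) = lemma k x y
  where
  lemma : ∀ k x y → suc k ℕ.+ (suc k ℕ.* x ℕ.+ suc k ℕ.* y)
        ≡ k ℕ.+ (k ℕ.* x ℕ.+ k ℕ.* y) ℕ.+ suc (x ℕ.+ y)
  lemma = ℕ-Solver.solve-∀
codeWeight-suc (suc n) k (((x , y) , ε) , c) =
  trans (cong (pairWeight (suc k) (x , y) ℕ.+ suc k ℕ.* bit ε ℕ.+_) (codeWeight-suc n (suc k) c))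
        (lemma k x y (bit ε) _ _)
  where
  lemma : ∀ k x y e w h → suc k ℕ.+ (suc k ℕ.* x ℕ.+ suc k ℕ.* y) ℕ.+ suc k ℕ.* e ℕ.+ (w ℕ.+ h)
        ≡ k ℕ.+ (k ℕ.* x ℕ.+ k ℕ.* y) ℕ.+ k ℕ.* e ℕ.+ w ℕ.+ (suc (x ℕ.+ y ℕ.+ e) ℕ.+ h)
  lemma = ℕ-Solver.solve-∀

-- Removing the first principal hook

-- Glues a column of length `length ps + h` to the left of the Young diagram.
fromColumns : ℕ → List ℕ → List ℕ
fromColumns h ps = map suc ps ++ replicate h 1

-- g and h are the excesses of the new arm and leg over the first row and the first
-- column of ps.
addHook : ℕ → ℕ → List ℕ → List ℕ
addHook g h ps = suc (g ℕ.+ part ps 0) ∷ fromColumns h ps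

Partition : List ℕ → Set
Partition ps = Linked _≥_ ps × All (0 <_) ps

fromColumns-linked : ∀ h {x ps} → part ps 0 < x → Linked _≥_ ps →
  Linked _≥_ (x ∷ fromColumns h ps)
fromColumns-linked zero    {ps = []}     _   _  = [-]
fromColumns-linked (suc h) {ps = []}     x>0 _  = x>0 ∷ fromColumns-linked h z<s []
fromColumns-linked h       {ps = p ∷ ps} x>p lp =
  x>p ∷ fromColumns-linked h (s≤s (first lp)) (Linked.tail lp)
  where
  first : ∀ {p ps} → Linked _≥_ (p ∷ ps) → part ps 0 ≤ p
  first [-]       = z≤n
  first (p≥q ∷ _) = p≥q

fromColumns-linked⁻ : ∀ {h ps} → Linked _≥_ (fromColumns h ps) → Linked _≥_ ps
fromColumns-linked⁻ {ps = []}         _             = []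
fromColumns-linked⁻ {ps = _ ∷ []}     _             = [-]
fromColumns-linked⁻ {ps = _ ∷ _ ∷ _} (s≤s p≥q ∷ l) = p≥q ∷ fromColumns-linked⁻ l

fromColumns-positive : ∀ h ps → All (0 <_) (fromColumns h ps)
fromColumns-positive zero    []       = []
fromColumns-positive (suc h) []       = z<s ∷ fromColumns-positive h []
fromColumns-positive h       (p ∷ ps) = z<s ∷ fromColumns-positive h ps

addHook-partition : ∀ g h {ps} → Partition ps → Partition (addHook g h ps)
addHook-partition g h {ps} (l , _) =
  fromColumns-linked h (s≤s (ℕ.m≤n+m (part ps 0) g)) l , z<s ∷ fromColumns-positive h ps

fromColumns-onto : ∀ {qs} → Linked _≥_ qs → All (0 <_) qs →
  ∃ λ h → ∃ λ ps → All (0 <_) ps × fromColumns h ps ≡ qs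
fromColumns-onto {[]}     _ _       = 0 , [] , [] , refl
fromColumns-onto {q ∷ qs} l (0< ∷ q+) with fromColumns-onto (Linked.tail l) q+
fromColumns-onto {suc zero ∷ _}    l           _ | h , [] , _ , refl = suc h , [] , [] , refl
-- A row of length 1 cannot be followed by a row coming from a positive part, which has length at
-- least 2.
fromColumns-onto {suc zero ∷ _}    (s≤s () ∷ _) _ | h , suc _ ∷ _ , _ ∷ _ , refl
fromColumns-onto {suc (suc p) ∷ _} l           _ | h , ps , ps+ , refl =
  h , suc p ∷ ps , z<s ∷ ps+ , refl

fromColumns-first : ∀ {q h ps} → Linked _≥_ (q ∷ fromColumns h ps) → 0 < q →
  part ps 0 < q
fromColumns-first {ps = []}    _        0<q = 0<q
fromColumns-first {ps = _ ∷ _} (q≥ ∷ _) _   = q≥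

addHook-onto : ∀ {q qs} → Partition (q ∷ qs) →
  ∃ λ g → ∃ λ h → ∃ λ ps → Partition ps × addHook g h ps ≡ q ∷ qs
addHook-onto {q} (l , q+ ∷ qs+) with fromColumns-onto (Linked.tail l) qs+
... | h , ps , ps+ , refl = q ℕ.∸ suc (part ps 0) , h , ps
  , (fromColumns-linked⁻ (Linked.tail l) , ps+)
  , cong (_∷ fromColumns h ps)
      (trans (sym (ℕ.+-suc (q ℕ.∸ suc (part ps 0)) (part ps 0)))
             (ℕ.m∸n+n≡m (fromColumns-first {h = h} {ps} l q+)))

-- Rows coming from positive parts have length at least 2, so they cannot be confused with the
-- appended rows of length 1.
fromColumns-injective : ∀ {h h′ ps ps′} → All (0 <_) ps → All (0 <_) ps′ →
  fromColumns h ps ≡ fromColumns h′ ps′ → h ≡ h′ × ps ≡ ps′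
fromColumns-injective {zero}  {zero}   []       []       _  = refl , refl
fromColumns-injective {suc h} {suc h′} []       []       eq
  with fromColumns-injective {h} {h′} [] [] (List.∷-injectiveʳ eq)
... | refl , _ = refl , refl
fromColumns-injective {suc _} {_} {ps′ = suc _ ∷ _} [] (_ ∷ _) eq
  with () ← List.∷-injectiveˡ eq
fromColumns-injective {_} {suc _} {ps = suc _ ∷ _} (_ ∷ _) [] eq
  with () ← List.∷-injectiveˡ eq
fromColumns-injective {h} {h′} (_ ∷ p) (_ ∷ p′) eq
  with List.∷-injectiveˡ eq | fromColumns-injective {h} {h′} p p′ (List.∷-injectiveʳ eq)
... | refl | refl , refl = refl , refl

addHook-injective : ∀ {g g′ h h′ ps ps′} → Partition ps → Partition ps′ →
  addHook g h ps ≡ addHook g′ h′ ps′ → g ≡ g′ × h ≡ h′ × ps ≡ ps′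
addHook-injective {g} {g′} {h} {h′} (_ , p) (_ , p′) eq
  with fromColumns-injective {h} {h′} p p′ (List.∷-injectiveʳ eq)
... | refl , refl = ℕ.+-cancelʳ-≡ _ g g′ (ℕ.suc-injective (List.∷-injectiveˡ eq)) , refl , refl

length-fromColumns : ∀ h ps → length (fromColumns h ps) ≡ length ps ℕ.+ h
length-fromColumns h ps = begin
  length (fromColumns h ps)                       ≡⟨ List.length-++ (map suc ps) ⟩
  length (map suc ps) ℕ.+ length (replicate h 1)
    ≡⟨ cong₂ ℕ._+_ (List.length-map suc ps) (List.length-replicate h) ⟩
  length ps ℕ.+ h                                 ∎
  where open ≡-Reasoning

sum-fromColumns : ∀ h ps → sum (fromColumns h ps) ≡ sum ps ℕ.+ length ps ℕ.+ h
sum-fromColumns zero    []       = refl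
sum-fromColumns (suc h) []       = cong suc (sum-fromColumns h [])
sum-fromColumns h       (p ∷ ps) =
  trans (cong (suc p ℕ.+_) (sum-fromColumns h ps)) (lemma p (sum ps) (length ps) h)
  where
  lemma : ∀ p s l h → suc p ℕ.+ (s ℕ.+ l ℕ.+ h) ≡ p ℕ.+ s ℕ.+ suc l ℕ.+ h
  lemma = ℕ-Solver.solve-∀

-- Cells, Durfee squares and principal hooks after adding a hook.

cell-fromColumns⁺ : ∀ h ps {i j} → Cell ps i j → Cell (fromColumns h ps) i (suc j)
cell-fromColumns⁺ h (p ∷ ps) {zero}  c = s<s c
cell-fromColumns⁺ h (p ∷ ps) {suc i} c = cell-fromColumns⁺ h ps c

cell-fromColumns⁻ : ∀ h ps {i j} → Cell (fromColumns h ps) i (suc j) → Cell ps i j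
cell-fromColumns⁻ (suc h) []       {zero}  (s≤s ())
cell-fromColumns⁻ (suc h) []       {suc i} c       with () ← cell-fromColumns⁻ h [] {i} c
cell-fromColumns⁻ h       (p ∷ ps) {zero}  (s<s c) = c
cell-fromColumns⁻ h       (p ∷ ps) {suc i} c       = cell-fromColumns⁻ h ps c

part-fromColumns : ∀ h ps {i j} → Cell ps i j → part (fromColumns h ps) i ≡ suc (part ps i)
part-fromColumns h (p ∷ ps) {zero}  c = refl
part-fromColumns h (p ∷ ps) {suc i} c = part-fromColumns h ps c

columnLength-0 : ∀ h ps → columnLength (fromColumns h ps) 0 ≡ length ps ℕ.+ h
columnLength-0 h ps = trans
  (cong length (List.filter-all (0 ℕ.<?_) (fromColumns-positive h ps))) (length-fromColumns h ps)

columnLength-suc : ∀ h ps j → columnLength (fromColumns h ps) (suc j) ≡ columnLength ps j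
columnLength-suc zero    []       j = refl
columnLength-suc (suc h) []       j = columnLength-suc h [] j
-- `suc j <ᵇ suc p` reduces to `j <ᵇ p`, so both filters branch on this Boolean.
columnLength-suc h       (p ∷ ps) j with j ℕ.<ᵇ p
... | true  = cong suc (columnLength-suc h ps j)
... | false = columnLength-suc h ps j

part-decreasing : ∀ {ps} i → Linked _≥_ ps → part ps i ≤ part ps 0
part-decreasing zero    _         = ℕ.≤-refl
part-decreasing (suc i) []        = z≤n
part-decreasing (suc i) [-]       = z≤n
part-decreasing (suc i) (p≥q ∷ l) = ℕ.≤-trans (part-decreasing i l) p≥q

containsSquare-addHook⁺ : ∀ {g h ps s} → ContainsSquare ps s → ContainsSquare (addHook g h ps) (suc s)
containsSquare-addHook⁺ sq zero    zero    _        _        = z<s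
containsSquare-addHook⁺ {g} {ps = ps} sq zero (suc j) _ (s<s j<) =
  s<s (ℕ.<-≤-trans (sq 0 j (ℕ.≤-trans z<s j<) j<) (ℕ.m≤n+m (part ps 0) g))
containsSquare-addHook⁺ {h = h} {ps} sq (suc i) zero (s<s i<) _ =
  ℕ.<-trans z<s (cell-fromColumns⁺ h ps (sq i 0 i< (ℕ.≤-trans z<s i<)))
containsSquare-addHook⁺ {h = h} {ps} sq (suc i) (suc j) (s<s i<) (s<s j<) =
  cell-fromColumns⁺ h ps (sq i j i< j<)

containsSquare-addHook⁻ : ∀ {g h ps s} → ContainsSquare (addHook g h ps) (suc s) → ContainsSquare ps s
containsSquare-addHook⁻ {h = h} {ps} sq i j i< j< =
  cell-fromColumns⁻ h ps (sq (suc i) (suc j) (s<s i<) (s<s j<))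

durfeeSize-addHook⁺ : ∀ {g h ps d} → DurfeeSize ps d → DurfeeSize (addHook g h ps) (suc d)
durfeeSize-addHook⁺ {g} {h} {ps} {d} (sq , max) = containsSquare-addHook⁺ {g} {h} {ps} sq , bound
  where
  bound : ∀ s → ContainsSquare (addHook g h ps) s → s ≤ suc d
  bound zero    _   = z≤n
  bound (suc s) sq′ = s≤s (max s (containsSquare-addHook⁻ {g} {h} {ps} sq′))

durfeeSize-addHook⁻ : ∀ {g h ps d} → DurfeeSize (addHook g h ps) (suc d) → DurfeeSize ps d
durfeeSize-addHook⁻ {g} {h} {ps} (sq , max) = containsSquare-addHook⁻ {g} {h} {ps} sq
  , λ s sq′ → ℕ.≤-pred (max (suc s) (containsSquare-addHook⁺ {g} {h} {ps} sq′))

hookLength-0 : ∀ g h ps →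
  hookLength (addHook g h ps) 0 0 ≡ suc (g ℕ.+ h ℕ.+ (part ps 0 ℕ.+ length ps))
hookLength-0 g h ps = trans
  (cong (λ l → g ℕ.+ part ps 0 ℕ.+ l ℕ.+ 1) (columnLength-0 h ps))
  (lemma g h (part ps 0) (length ps))
  where
  lemma : ∀ g h a l → g ℕ.+ a ℕ.+ (l ℕ.+ h) ℕ.+ 1 ≡ suc (g ℕ.+ h ℕ.+ (a ℕ.+ l))
  lemma = ℕ-Solver.solve-∀

-- Row and column of an old cell each gain one cell, offset by the shift of the indices. The column
-- gains its cell from the new first row, which reaches that far because the rows of `ps` decrease
-- weakly.
hookLength-suc : ∀ g h {ps} i → Linked _≥_ ps → Cell ps i i →
  hookLength (addHook g h ps) (suc i) (suc i) ≡ hookLength ps i i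
hookLength-suc g h {ps} i l c = cong₂ (λ a b → a ℕ.+ b ℕ.+ 1)
  (cong (ℕ._∸ suc (suc i)) (part-fromColumns h ps c))
  (cong (ℕ._∸ suc (suc i)) (trans
    (cong length (List.filter-accept (suc i ℕ.<?_) (s<s (ℕ.<-≤-trans c
      (ℕ.≤-trans (part-decreasing i l) (ℕ.m≤n+m (part ps 0) g))))))
    (cong suc (columnLength-suc h ps i))))

principalHooksEven-addHook⁺ : ∀ {g h ps} → Linked _≥_ ps →
  2 ∣ suc (g ℕ.+ h ℕ.+ (part ps 0 ℕ.+ length ps)) → PrincipalHooksEven ps →
  PrincipalHooksEven (addHook g h ps)
principalHooksEven-addHook⁺ {g} {h} {ps} l even hooks zero    _ =
  subst (2 ∣_) (sym (hookLength-0 g h ps)) even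
principalHooksEven-addHook⁺ {g} {h} {ps} l even hooks (suc i) c =
  subst (2 ∣_) (sym (hookLength-suc g h i l c′)) (hooks i c′)
  where
  c′ : Cell ps i i
  c′ = cell-fromColumns⁻ h ps c

principalHooksEven-addHook⁻ : ∀ {g h ps} → Linked _≥_ ps → PrincipalHooksEven (addHook g h ps) →
  2 ∣ suc (g ℕ.+ h ℕ.+ (part ps 0 ℕ.+ length ps)) × PrincipalHooksEven ps
principalHooksEven-addHook⁻ {g} {h} {ps} l hooks =
  subst (2 ∣_) (hookLength-0 g h ps) (hooks 0 z<s)
  , λ i c → subst (2 ∣_) (hookLength-suc g h i l c) (hooks (suc i) (cell-fromColumns⁺ h ps c))

-- Parities of arms and legs, and the partition of a code.

twice : Bool → ℕ → ℕ
twice o x = bit o ℕ.+ 2 ℕ.* x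

twice-injective : ∀ {o o′} x x′ → twice o x ≡ twice o′ x′ → o ≡ o′ × x ≡ x′
twice-injective {false} {false} x x′ eq = refl , ℕ.*-cancelˡ-≡ x x′ 2 eq
twice-injective {false} {true}  x x′ eq = contradiction eq (ℕ.even≢odd x x′)
twice-injective {true}  {false} x x′ eq = contradiction (sym eq) (ℕ.even≢odd x′ x)
twice-injective {true}  {true}  x x′ eq = refl , ℕ.*-cancelˡ-≡ x x′ 2 (ℕ.suc-injective eq)

parity : ∀ n → ∃ λ o → ∃ λ x → twice o x ≡ n
parity zero = false , 0 , refl
parity (suc n) with parity n
... | false , x , refl = true , x , refl
... | true  , x , refl = false , suc x , ℕ.*-suc 2 x

odd-indivisible : ∀ {n} k → n ≡ suc (2 ℕ.* k) → 2 ∤ n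
odd-indivisible k eq (divides q eq′) =
  ℕ.even≢odd q k (trans (ℕ.*-comm 2 q) (trans (sym eq′) eq))

twice-+ : ∀ o o′ x y → twice o x ℕ.+ twice o′ y ≡ bit o ℕ.+ bit o′ ℕ.+ 2 ℕ.* (x ℕ.+ y)
twice-+ o o′ x y = lemma (bit o) (bit o′) x y
  where
  lemma : ∀ a b x y → a ℕ.+ 2 ℕ.* x ℕ.+ (b ℕ.+ 2 ℕ.* y) ≡ a ℕ.+ b ℕ.+ 2 ℕ.* (x ℕ.+ y)
  lemma = ℕ-Solver.solve-∀

-- For the increments of arm and leg from a hook to the next outer one: unequal parities would have
-- an odd sum, so one bit serves both.
sameParity : ∀ g h → 2 ∣ g ℕ.+ h → ∃ λ o → ∃ λ x → ∃ λ y → twice o x ≡ g × twice o y ≡ h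
sameParity g h even with parity g | parity h
... | false , x , p    | false , y , q    = false , x , y , p , q
... | true  , x , p    | true  , y , q    = true , x , y , p , q
... | false , x , refl | true  , y , refl =
  contradiction even (odd-indivisible (x ℕ.+ y) (twice-+ false true x y))
... | true  , x , refl | false , y , refl =
  contradiction even (odd-indivisible (x ℕ.+ y) (twice-+ true false x y))

-- For the innermost hook: the corner cell counts 1, so arm plus leg is odd, and the bit tells which
-- of the two is odd.
oppositeParity : ∀ g h → 2 ∣ suc (g ℕ.+ h) →
  ∃ λ o → ∃ λ x → ∃ λ y → twice o x ≡ g × twice (not o) y ≡ h
oppositeParity g h even with parity g | parity h
... | false , x , p    | true  , y , q    = false , x , y , p , q
... | true  , x , p    | false , y , q    = true , x , y , p , q
... | false , x , refl | false , y , refl =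
  contradiction even (odd-indivisible (x ℕ.+ y) (cong suc (twice-+ false false x y)))
... | true  , x , refl | true  , y , refl =
  contradiction even (odd-indivisible (suc (x ℕ.+ y))
    (cong suc (trans (twice-+ true true x y) (sym (ℕ.*-suc 2 (x ℕ.+ y))))))

-- The arm and the leg of the innermost hook have opposite parities; the
-- increments of arm and leg from each hook to the next outer one agree in parity.
decode : ∀ n → Bool → Code n → List ℕ
decode zero    β (x , y)             = addHook (twice β x) (twice (not β) y) []
decode (suc n) β (((x , y) , ε) , c) = addHook (twice ε x) (twice ε y) (decode n β c)

-- The length of the innermost hook: exactly one of `β` and `not β` adds 1, and the corner another.
-- The final 0 comes from the empty partition inside.
twice-not : ∀ β x y → suc (twice β x ℕ.+ twice (not β) y ℕ.+ 0) ≡ 2 ℕ.* suc (x ℕ.+ y)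
twice-not false = lemma
  where
  lemma : ∀ x y → suc (2 ℕ.* x ℕ.+ suc (2 ℕ.* y) ℕ.+ 0) ≡ 2 ℕ.* suc (x ℕ.+ y)
  lemma = ℕ-Solver.solve-∀
twice-not true  = lemma
  where
  lemma : ∀ x y → suc (suc (2 ℕ.* x) ℕ.+ 2 ℕ.* y ℕ.+ 0) ≡ 2 ℕ.* suc (x ℕ.+ y)
  lemma = ℕ-Solver.solve-∀

-- First row and first column share the corner, so the first hook has one cell less than their
-- total.
decode-extent : ∀ n β c →
  part (decode n β c) 0 ℕ.+ length (decode n β c) ≡ suc (2 ℕ.* height n c)
decode-extent zero β (x , y) = begin
  suc (twice β x ℕ.+ 0) ℕ.+ suc (length (fromColumns (twice (not β) y) []))
    ≡⟨ cong (λ l → suc (twice β x ℕ.+ 0) ℕ.+ suc l) (length-fromColumns (twice (not β) y) []) ⟩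
  suc (twice β x ℕ.+ 0) ℕ.+ suc (twice (not β) y)
    ≡⟨ lemma (twice β x) (twice (not β) y) ⟩
  suc (suc (twice β x ℕ.+ twice (not β) y ℕ.+ 0))
    ≡⟨ cong suc (twice-not β x y) ⟩
  suc (2 ℕ.* suc (x ℕ.+ y)) ∎
  where
  open ≡-Reasoning
  lemma : ∀ a b → suc (a ℕ.+ 0) ℕ.+ suc b ≡ suc (suc (a ℕ.+ b ℕ.+ 0))
  lemma = ℕ-Solver.solve-∀
decode-extent (suc n) β (((x , y) , ε) , c) = begin
  suc (twice ε x ℕ.+ part ps 0) ℕ.+ suc (length (fromColumns (twice ε y) ps))
    ≡⟨ cong (λ l → suc (twice ε x ℕ.+ part ps 0) ℕ.+ suc l) (length-fromColumns (twice ε y) ps) ⟩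
  suc (twice ε x ℕ.+ part ps 0) ℕ.+ suc (length ps ℕ.+ twice ε y)
    ≡⟨ lemma (bit ε) x y (part ps 0) (length ps) ⟩
  2 ℕ.* suc (x ℕ.+ y ℕ.+ bit ε) ℕ.+ (part ps 0 ℕ.+ length ps)
    ≡⟨ cong (2 ℕ.* suc (x ℕ.+ y ℕ.+ bit ε) ℕ.+_) (decode-extent n β c) ⟩
  2 ℕ.* suc (x ℕ.+ y ℕ.+ bit ε) ℕ.+ suc (2 ℕ.* height n c)
    ≡⟨ lemma′ (suc (x ℕ.+ y ℕ.+ bit ε)) (height n c) ⟩
  suc (2 ℕ.* (suc (x ℕ.+ y ℕ.+ bit ε) ℕ.+ height n c)) ∎
  where
  open ≡-Reasoning
  ps : List ℕ
  ps = decode n β c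
  lemma : ∀ e x y a l → suc (e ℕ.+ 2 ℕ.* x ℕ.+ a) ℕ.+ suc (l ℕ.+ (e ℕ.+ 2 ℕ.* y))
        ≡ 2 ℕ.* suc (x ℕ.+ y ℕ.+ e) ℕ.+ (a ℕ.+ l)
  lemma = ℕ-Solver.solve-∀
  lemma′ : ∀ a b → 2 ℕ.* a ℕ.+ suc (2 ℕ.* b) ≡ suc (2 ℕ.* (a ℕ.+ b))
  lemma′ = ℕ-Solver.solve-∀

sum-addHook : ∀ g h ps →
  sum (addHook g h ps) ≡ suc (g ℕ.+ h ℕ.+ (part ps 0 ℕ.+ length ps)) ℕ.+ sum ps
sum-addHook g h ps = trans
  (cong (suc (g ℕ.+ part ps 0) ℕ.+_) (sum-fromColumns h ps))
  (lemma g h (part ps 0) (length ps) (sum ps))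
  where
  lemma : ∀ g h a l s → suc (g ℕ.+ a) ℕ.+ (s ℕ.+ l ℕ.+ h) ≡ suc (g ℕ.+ h ℕ.+ (a ℕ.+ l)) ℕ.+ s
  lemma = ℕ-Solver.solve-∀

-- The left side is the number of cells of the added hook, hence both its principal hook length and
-- the increase of the sum.
decode-hook : ∀ n β x y ε c →
  suc (twice ε x ℕ.+ twice ε y ℕ.+ (part (decode n β c) 0 ℕ.+ length (decode n β c)))
    ≡ 2 ℕ.* (suc (x ℕ.+ y ℕ.+ bit ε) ℕ.+ height n c)
decode-hook n β x y ε c = trans
  (cong (λ e → suc (twice ε x ℕ.+ twice ε y ℕ.+ e)) (decode-extent n β c))
  (lemma (bit ε) x y (height n c))
  where
  lemma : ∀ e x y t → suc (e ℕ.+ 2 ℕ.* x ℕ.+ (e ℕ.+ 2 ℕ.* y) ℕ.+ suc (2 ℕ.* t))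
        ≡ 2 ℕ.* (suc (x ℕ.+ y ℕ.+ e) ℕ.+ t)
  lemma = ℕ-Solver.solve-∀

-- The principal hooks tile the diagram, and the i-th column of the code adds to the lengths of
-- hooks 1, ..., i; hence its multiplicity i.
sum-decode : ∀ n β c → sum (decode n β c) ≡ 2 ℕ.* codeWeight n 1 c
sum-decode zero β (x , y) = begin
  sum (addHook (twice β x) (twice (not β) y) [])
    ≡⟨ sum-addHook (twice β x) (twice (not β) y) [] ⟩
  suc (twice β x ℕ.+ twice (not β) y ℕ.+ 0) ℕ.+ 0
    ≡⟨ cong (ℕ._+ 0) (twice-not β x y) ⟩
  2 ℕ.* suc (x ℕ.+ y) ℕ.+ 0
    ≡⟨ lemma x y ⟩
  2 ℕ.* pairWeight 1 (x , y) ∎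
  where
  open ≡-Reasoning
  lemma : ∀ x y → 2 ℕ.* suc (x ℕ.+ y) ℕ.+ 0 ≡ 2 ℕ.* (1 ℕ.+ (1 ℕ.* x ℕ.+ 1 ℕ.* y))
  lemma = ℕ-Solver.solve-∀
sum-decode (suc n) β (((x , y) , ε) , c) = begin
  sum (addHook (twice ε x) (twice ε y) (decode n β c))
    ≡⟨ sum-addHook (twice ε x) (twice ε y) (decode n β c) ⟩
  suc (twice ε x ℕ.+ twice ε y ℕ.+ (part (decode n β c) 0 ℕ.+ length (decode n β c)))
    ℕ.+ sum (decode n β c)
    ≡⟨ cong₂ ℕ._+_ (decode-hook n β x y ε c) (sum-decode n β c) ⟩
  2 ℕ.* (suc (x ℕ.+ y ℕ.+ bit ε) ℕ.+ height n c) ℕ.+ 2 ℕ.* codeWeight n 1 c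
    ≡⟨ lemma x y (bit ε) (height n c) (codeWeight n 1 c) ⟩
  2 ℕ.* (column ℕ.+ (codeWeight n 1 c ℕ.+ height n c))
    ≡⟨ cong (λ w → 2 ℕ.* (column ℕ.+ w)) (codeWeight-suc n 1 c) ⟨
  2 ℕ.* (column ℕ.+ codeWeight n 2 c) ∎
  where
  open ≡-Reasoning
  column : ℕ
  column = pairWeight 1 (x , y) ℕ.+ 1 ℕ.* bit ε
  lemma : ∀ x y e t w → 2 ℕ.* (suc (x ℕ.+ y ℕ.+ e) ℕ.+ t) ℕ.+ 2 ℕ.* w
        ≡ 2 ℕ.* (1 ℕ.+ (1 ℕ.* x ℕ.+ 1 ℕ.* y) ℕ.+ 1 ℕ.* e ℕ.+ (w ℕ.+ t))
  lemma = ℕ-Solver.solve-∀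

durfeeSize-[] : DurfeeSize [] 0
durfeeSize-[] = (λ _ _ ()) , bound
  where
  bound : ∀ s → ContainsSquare [] s → s ≤ 0
  bound zero    _  = z≤n
  bound (suc s) sq with () ← sq 0 0 z<s z<s

decode-partition : ∀ n β c → Partition (decode n β c)
decode-partition zero    β (x , y)             =
  addHook-partition (twice β x) (twice (not β) y) ([] , [])
decode-partition (suc n) β (((x , y) , ε) , c) =
  addHook-partition (twice ε x) (twice ε y) (decode-partition n β c)

decode-durfeeSize : ∀ n β c → DurfeeSize (decode n β c) (suc n)
decode-durfeeSize zero    β (x , y)             =
  durfeeSize-addHook⁺ {twice β x} {twice (not β) y} durfeeSize-[]
decode-durfeeSize (suc n) β (((x , y) , ε) , c) =
  durfeeSize-addHook⁺ {twice ε x} {twice ε y} (decode-durfeeSize n β c)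

decode-even : ∀ n β c → PrincipalHooksEven (decode n β c)
decode-even zero    β (x , y)             =
  principalHooksEven-addHook⁺ {twice β x} {twice (not β) y} []
    (subst (2 ∣_) (sym (twice-not β x y)) (m∣m*n (suc (x ℕ.+ y)))) (λ _ ())
decode-even (suc n) β (((x , y) , ε) , c) =
  principalHooksEven-addHook⁺ {twice ε x} {twice ε y} (proj₁ (decode-partition n β c))
    (subst (2 ∣_) (sym (decode-hook n β x y ε c))
      (m∣m*n (suc (x ℕ.+ y ℕ.+ bit ε) ℕ.+ height n c))) (decode-even n β c)

decode-injective : ∀ n {β β′} c c′ → decode n β c ≡ decode n β′ c′ → β ≡ β′ × c ≡ c′
decode-injective zero {β} {β′} (x , y) (x′ , y′) eq
  with addHook-injective {twice β x} {twice β′ x′} {twice (not β) y} {twice (not β′) y′}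
         ([] , []) ([] , []) eq
... | p , q , _ with twice-injective {β} {β′} x x′ p | twice-injective {not β} {not β′} y y′ q
... | refl , refl | _ , refl = refl , refl
decode-injective (suc n) {β} {β′} (((x , y) , ε) , c) (((x′ , y′) , ε′) , c′) eq
  with addHook-injective {twice ε x} {twice ε′ x′} {twice ε y} {twice ε′ y′}
         (decode-partition n β c) (decode-partition n β′ c′) eq
... | p , q , r
  with twice-injective {ε} {ε′} x x′ p | twice-injective {ε} {ε′} y y′ q | decode-injective n c c′ r
... | refl , refl | _ , refl | refl , refl = refl , refl

durfeeSize-0 : ∀ {ps} → Partition ps → DurfeeSize ps 0 → ps ≡ []
durfeeSize-0 {[]}     _            _         = refl
durfeeSize-0 {p ∷ ps} (_ , 0<p ∷ _) (_ , max) = contradiction (max 1 corner) λ ()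
  where
  corner : ContainsSquare (p ∷ ps) 1
  corner zero zero _ _ = 0<p
  corner (suc _) _ (s≤s ()) _
  corner zero (suc _) _ (s≤s ())

-- The inner first row and column have an odd total, so together with the new corner they contribute
-- an even number to the new hook.
even-increments : ∀ n β c {g h} →
  2 ∣ suc (g ℕ.+ h ℕ.+ (part (decode n β c) 0 ℕ.+ length (decode n β c))) → 2 ∣ g ℕ.+ h
even-increments n β c {g} {h} even = ∣m+n∣m⇒∣n
  (subst (2 ∣_) (trans (cong (λ e → suc (g ℕ.+ h ℕ.+ e)) (decode-extent n β c))
                       (lemma (g ℕ.+ h) (height n c))) even)
  (m∣m*n (suc (height n c)))
  where
  lemma : ∀ a t → suc (a ℕ.+ suc (2 ℕ.* t)) ≡ 2 ℕ.* suc t ℕ.+ a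
  lemma = ℕ-Solver.solve-∀

-- Stripping the first hook lowers the Durfee size by one. Its even length then yields a bit,
-- through opposite parities at the innermost hook and equal ones elsewhere.
decode-onto : ∀ n {ps} → Partition ps → DurfeeSize ps (suc n) → PrincipalHooksEven ps →
  ∃ λ β → ∃ λ c → decode n β c ≡ ps
decode-onto n {[]} _ (sq , _) _ with () ← sq 0 0 z<s z<s
decode-onto n {q ∷ qs} part durfee even with addHook-onto part
... | g , h , ps , partition , refl
  with durfeeSize-addHook⁻ {g} {h} {ps} durfee
     | principalHooksEven-addHook⁻ {g} {h} {ps} (proj₁ partition) even
decode-onto zero _ _ _ | g , h , ps , partition , refl | durfee | hook , _
  with durfeeSize-0 partition durfee
... | refl with oppositeParity g h (subst (λ e → 2 ∣ suc e) (ℕ.+-identityʳ (g ℕ.+ h)) hook)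
... | β , x , y , refl , refl = β , (x , y) , refl
decode-onto (suc n) _ _ _ | g , h , ps , partition , refl | durfee | hook , even
  with decode-onto n partition durfee even
... | β , c , refl
  with sameParity g h (even-increments n β c {g} {h} hook)
... | ε , x , y , refl , refl = β , (((x , y) , ε) , c) , refl

evenHook-count : ∀ n m →
  Count (EvenHookPartition (suc n) (2 ℕ.* m)) ((const (+ 2) · codeGF n 1) m)
evenHook-count n m = count-refinement (List.≡-dec ℕ._≟_)
  (λ ((β , c) , _) → decode n β c)
  (λ { ((β , c) , refl) → (proj₁ (decode-partition n β c) , proj₂ (decode-partition n β c)
                          , sum-decode n β c)
                        , decode-durfeeSize n β c , decode-even n β c })
  (λ {((β , c) , _)} {((β′ , c′) , _)} eq →
    let p , q = decode-injective n c c′ eq in fiber-≡ (cong₂ _,_ p q))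
  (λ { ((l , p , s) , durfee , even) → onto (l , p) s durfee even })
  (hasGF-marked n m)
  where
  onto : ∀ {ps} → Partition ps → sum ps ≡ 2 ℕ.* m → DurfeeSize ps (suc n) →
    PrincipalHooksEven ps →
    ∃ λ (u : Fiber (markedWeight n) m) → decode n (proj₁ (proj₁ u)) (proj₂ (proj₁ u)) ≡ ps
  onto partition s durfee even with decode-onto n partition durfee even
  ... | β , c , refl =
    ((β , c) , ℕ.*-cancelˡ-≡ _ m 2 (trans (sym (sum-decode n β c)) s)) , refl

evenHook-empty : ∀ m → Count (EvenHookPartition 0 (2 ℕ.* m)) (𝟙 m)
evenHook-empty m = count-refinement (List.≡-dec ℕ._≟_)
  (λ _ → [])
  (λ { (_ , refl) → ([] , [] , refl) , durfeeSize-[] , λ _ () })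
  (λ _ → fiber-≡ refl)
  (λ { ((l , p , s) , durfee , _) → onto s (durfeeSize-0 (l , p) durfee) })
  (subst (Count _) (q^0≗𝟙 m) (hasGF-point 0 m))
  where
  onto : ∀ {ps} → sum ps ≡ 2 ℕ.* m → ps ≡ [] → ∃ λ (u : Fiber {⊤} (λ _ → 0) m) → [] ≡ ps
  onto s refl = (tt , ℕ.*-cancelˡ-≡ 0 m 2 s) , refl

-- Frobenius arrays

top : ∀ n → Code n → Vec ℕ (suc n)
top zero    (x , _)           = x ∷ []
top (suc n) (((x , _) , _) , c) = x ℕ.+ suc (head (top n c)) ∷ top n c

-- ε marks a strict drop towards an overlined entry of the next column, so each
-- column hands its bit to the next one.
bottom : ∀ n → Bool → Code n → Vec OverPart (suc n)
bottom zero    o (_ , y)           = (y , o) ∷ []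
bottom (suc n) o (((_ , y) , ε) , c) =
  (y ℕ.+ bit ε ℕ.+ proj₁ (head (bottom n ε c)) , o) ∷ bottom n ε c

top-strict : ∀ n c → VecLinked.Linked _>_ (top n c)
top-strict zero    _                    = [-]
top-strict (suc n) (((x , _) , _) , c) = ℕ.m≤n+m _ x ∷ top-strict n c

Overlinable : OverPart → OverPart → Set
Overlinable (v , _) (w , o) = o ≡ true → v ≢ w

-- Checking the adjacent entry suffices: a later overlined entry equal to `v` would by monotonicity
-- also equal `w`, against the condition for `w`.
overlinable-cons : ∀ {n v o w o′} {ws : Vec OverPart n} → v ≥ w →
  Overlinable (v , o) (w , o′) → IsOverpartition ((w , o′) ∷ ws) →
  IsOverpartition ((v , o) ∷ (w , o′) ∷ ws)
overlinable-cons {v = v} {o} {w} {o′} v≥w ov (l , ps@(p ∷ _)) =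
  v≥w ∷ l , (ov ∷ rest _ ℕ.≤-refl l p) ∷ ps
  where
  rest : ∀ {m u} (us : Vec OverPart m) → w ≥ u →
    VecLinked.Linked _≥_ (u ∷ Vec.map proj₁ us) →
    VecAll.All (Overlinable (w , o′)) us → VecAll.All (Overlinable (v , o)) us
  rest []             _   _         []       = []
  rest ((z , _) ∷ us) w≥u (u≥z ∷ l) (q ∷ qs) =
    (λ oz v≡z → q oz (ℕ.≤-antisym (subst (w ≤_) v≡z v≥w) (ℕ.≤-trans u≥z w≥u)))
    ∷ rest us (ℕ.≤-trans u≥z w≥u) l qs

bottom-overpartition : ∀ n o c → IsOverpartition (bottom n o c)
bottom-overpartition zero    o _                    = [-] , [] ∷ []
bottom-overpartition (suc n) o (((_ , y) , ε) , c)
  -- The overline of the next entry is `ε` itself, so the drop is strict whenever that entry is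
  -- overlined.
  with bottom n ε c | head-bottom n {ε} c | bottom-overpartition n ε c
  where
  head-bottom : ∀ n {o} c → proj₂ (head (bottom n o c)) ≡ o
  head-bottom zero    _ = refl
  head-bottom (suc _) _ = refl
... | (w , _) ∷ _ | refl | ih = overlinable-cons (ℕ.m≤n+m w (y ℕ.+ bit ε)) (strict ε) ih
  where
  strict : ∀ ε → ε ≡ true → y ℕ.+ bit ε ℕ.+ w ≢ w
  strict true _ eq = ℕ.m+1+n≢n y (trans (sym (ℕ.+-assoc y 1 w)) eq)

code-height : ∀ n o c → suc (head (top n c) ℕ.+ proj₁ (head (bottom n o c))) ≡ height n c
code-height zero    o _                    = refl
code-height (suc n) o (((x , y) , ε) , c) =
  trans (lemma x y (bit ε) (head (top n c)) (proj₁ (head (bottom n ε c))))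
        (cong (suc (x ℕ.+ y ℕ.+ bit ε) ℕ.+_) (code-height n ε c))
  where
  lemma : ∀ x y e t b → suc (x ℕ.+ suc t ℕ.+ (y ℕ.+ e ℕ.+ b))
                      ≡ suc (x ℕ.+ y ℕ.+ e) ℕ.+ suc (t ℕ.+ b)
  lemma = ℕ-Solver.solve-∀

code-weight : ∀ n o c → weight (top n c , bottom n o c) ≡ codeWeight n 1 c
code-weight zero    o (x , y) = lemma x y
  where
  lemma : ∀ x y → 1 ℕ.+ (x ℕ.+ 0) ℕ.+ (y ℕ.+ 0) ≡ 1 ℕ.+ (1 ℕ.* x ℕ.+ 1 ℕ.* y)
  lemma = ℕ-Solver.solve-∀
code-weight (suc n) o (((x , y) , ε) , c) = begin
  weight (top (suc n) d , bottom (suc n) o d)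
    -- The new first column weighs `column` more than the old one, so the old column's weight
    -- `suc (t + b)` appears a second time.
    ≡⟨ lemma n x y (bit ε) t b (Vec.sum (top n c)) _ ⟩
  column ℕ.+ (weight (top n c , bottom n ε c) ℕ.+ suc (t ℕ.+ b))
    ≡⟨ cong₂ (λ w h → column ℕ.+ (w ℕ.+ h)) (code-weight n ε c) (code-height n ε c) ⟩
  column ℕ.+ (codeWeight n 1 c ℕ.+ height n c)
    ≡⟨ cong (column ℕ.+_) (codeWeight-suc n 1 c) ⟨
  column ℕ.+ codeWeight n 2 c ∎
  where
  open ≡-Reasoning
  d : Code (suc n)
  d = ((x , y) , ε) , c
  column t b : ℕ
  column = pairWeight 1 (x , y) ℕ.+ 1 ℕ.* bit ε
  t      = head (top n c)
  b      = proj₁ (head (bottom n ε c))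
  lemma : ∀ n x y e t b s u →
    suc (suc n) ℕ.+ (x ℕ.+ suc t ℕ.+ s) ℕ.+ (y ℕ.+ e ℕ.+ b ℕ.+ u)
      ≡ 1 ℕ.+ (1 ℕ.* x ℕ.+ 1 ℕ.* y) ℕ.+ 1 ℕ.* e
        ℕ.+ (suc n ℕ.+ s ℕ.+ u ℕ.+ suc (t ℕ.+ b))
  lemma = ℕ-Solver.solve-∀

rows-injective : ∀ n {o o′} c c′ → top n c ≡ top n c′ → bottom n o c ≡ bottom n o′ c′ →
  o ≡ o′ × c ≡ c′
rows-injective zero    _ _ refl refl = refl , refl
rows-injective (suc n) (((x , y) , ε) , c) (((x′ , y′) , ε′) , c′) p q
  with Vec.∷-injective p | Vec.∷-injective q
-- The later columns are compared first: they determine `ε` and the entries at which the drops end,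
-- after which the drops can be cancelled.
... | p₁ , p₂ | q₁ , q₂ with rows-injective n c c′ p₂ q₂ | cong proj₂ q₁
... | refl , refl | refl with ℕ.+-cancelʳ-≡ _ x x′ p₁
  | ℕ.+-cancelʳ-≡ (bit ε) y y′ (ℕ.+-cancelʳ-≡ _ _ _ (cong proj₁ q₁))
... | refl | refl = refl , refl

-- An overlined entry is never reached by a zero drop, so `bit o` can be subtracted from the drop.
drop : ∀ {v w} o → v ≥ w → (o ≡ true → v ≢ w) → ∃ λ y → y ℕ.+ bit o ℕ.+ w ≡ v
drop {v} {w} false v≥w _ =
  v ℕ.∸ w , trans (cong (ℕ._+ w) (ℕ.+-identityʳ (v ℕ.∸ w))) (ℕ.m∸n+n≡m v≥w)
drop {v} {w} true  v≥w v≢w =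
  v ℕ.∸ suc w , trans (ℕ.+-assoc (v ℕ.∸ suc w) 1 w)
    (ℕ.m∸n+n≡m (ℕ.≤∧≢⇒< v≥w (λ w≡v → v≢w refl (sym w≡v))))

-- Each bit is read off the overline in the next column; x and y are what remains of the drops in
-- the two rows.
rows-onto : ∀ n {t b} → VecLinked.Linked _>_ t → IsOverpartition b →
  ∃ λ c → top n c ≡ t × bottom n (proj₂ (head b)) c ≡ b
rows-onto zero    {x ∷ []} {(y , o) ∷ []} _ _ = (x , y) , refl , refl
rows-onto (suc n) {x ∷ t} {(v , o) ∷ (w , ε) ∷ b} (x> ∷ lt) (v≥w ∷ lb , (ov ∷ _) ∷ ps)
  with rows-onto n lt (lb , ps) | drop ε v≥w ov
... | c , refl , eq | y , refl =
  (((x ℕ.∸ suc (head (top n c)) , y) , ε) , c)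
  , cong (_∷ top n c) (ℕ.m∸n+n≡m x>)
  , cong₂ (λ h r → (y ℕ.+ bit ε ℕ.+ proj₁ h , o) ∷ r) (cong head eq) eq

frobenius-count : ∀ n m → Count (FrobeniusArray (suc n) m) ((const (+ 2) · codeGF n 1) m)
frobenius-count n m = count-refinement
  (Product.≡-dec (Vec.≡-dec ℕ._≟_) (Vec.≡-dec (Product.≡-dec ℕ._≟_ Bool._≟_)))
  (λ ((o , c) , _) → top n c , bottom n o c)
  (λ { ((o , c) , refl) → top-strict n c , bottom-overpartition n o c , code-weight n o c })
  (λ {((o , c) , _)} {((o′ , c′) , _)} eq →
    let p , q = rows-injective n c c′ (cong proj₁ eq) (cong proj₂ eq)
    in fiber-≡ (cong₂ _,_ p q))
  (λ { (lt , ov , refl) → onto lt ov })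
  (hasGF-marked n m)
  where
  onto : ∀ {t b} → VecLinked.Linked _>_ t → IsOverpartition b →
    ∃ λ (u : Fiber (markedWeight n) (weight (t , b))) →
      (top n (proj₂ (proj₁ u)) , bottom n (proj₁ (proj₁ u)) (proj₂ (proj₁ u))) ≡ (t , b)
  onto {t} {b} lt ov with rows-onto n lt ov
  ... | c , p , q = ((proj₂ (head b) , c)
    , trans (sym (code-weight n _ c)) (cong₂ (λ t b → weight (t , b)) p q)) , cong₂ _,_ p q

frobenius-empty : ∀ m → Count (FrobeniusArray 0 m) (𝟙 m)
frobenius-empty zero    = count-singleton
  (([] , []) , [ [] , ([] , []) , refl ]) λ { (([] , []) , _) → refl }
frobenius-empty (suc m) = count-empty λ { (([] , []) , [ p ]) → impossible p }
  where
  impossible : .(IsFrobeniusArray 0 (suc m) ([] , [])) → ⊥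
  impossible ()

theorem5p3 : (∀ d → 1 ≤ d →
    generatingFunction (H d)
    ≗ const (+ 2) · q^ ((d + 1) C 2) · poch (⊝ (q^ 1)) (d ∸ 1)
    ÷ (poch (q^ 1) d · poch (q^ 1) d) [ poch-q²-constant d ])
    × generatingFunction (H 0) ≗ 𝟙
    × (∀ d → 1 ≤ d →
    const (+ 2) · q^ ((d + 1) C 2) · poch (⊝ (q^ 1)) (d ∸ 1)
    ÷ (poch (q^ 1) d · poch (q^ 1) d) [ poch-q²-constant d ]
    ≗ generatingFunction (O d))
    × (∀ m d → H d m ≡ O d m)
theorem5p3 =
    (λ { (suc n) _ m → trans (H-suc n m) (marked-formula n m) })
  , H-zero
  , (λ { (suc n) _ m → sym (trans (O-suc n m) (marked-formula n m)) })
  , λ { m zero    → ℤ.+-injective (trans (H-zero m) (sym (O-zero m)))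
      ; m (suc n) → ℤ.+-injective (trans (H-suc n m) (sym (O-suc n m))) }
  where
  H-zero : generatingFunction (H 0) ≗ 𝟙
  H-zero m = count-size (evenHookPartition-finite 0 (2 ℕ.* m)) (evenHook-empty m)
  O-zero : generatingFunction (O 0) ≗ 𝟙
  O-zero m = count-size (frobeniusArray-finite 0 m) (frobenius-empty m)
  H-suc : ∀ n → generatingFunction (H (suc n)) ≗ const (+ 2) · codeGF n 1
  H-suc n m = count-size (evenHookPartition-finite (suc n) (2 ℕ.* m)) (evenHook-count n m)
  O-suc : ∀ n → generatingFunction (O (suc n)) ≗ const (+ 2) · codeGF n 1
  O-suc n m = count-size (frobeniusArray-finite (suc n) m) (frobenius-count n m)
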